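{- Let $\mathcal A\subseteq\mathbb N$ be such that for every $n_1\in\mathbb N$ it is decidable whether there exists $n_2\in\mathcal A$ with $n_1\le n_2$. Then for every environment $L$ and terms $T,U$ it is decidable whether $L\vdash_{\mathcal A}T:U$.
   Context: Fix a nonempty set $\Sigma$ of sorts with decidable equality, a (computable) function $\mathrm{next}:\Sigma\to\Sigma$, and a countably infinite set of variables with decidable equality. Terms and environments: $T,U,V,W ::= \star s \mid x \mid \mathrm{app}(V,T) \mid \lambda x{:}W.\,T \mid \mathrm{def}(x{=}V).\,T \mid \mathrm{cast}(U,T)$ ($s\in\Sigma$) and $L,K ::= \emptyset \mid K,x{:}W \mid K,x{=}V$. $\mathrm{app}(V,T)$ applies $T$ to $V$; $\lambda x{:}W.\,T$ (de Bruijn's abstraction) and $\mathrm{def}(x{=}V).\,T$ (local definition) bind $x$ in $T$; $\mathrm{cast}(U,T)$ annotates $T$ with expected type $U$; entries $x{:}W$ and $x{=}V$ bind $x$. Terms are modulo renaming of bound variables. Write $\mathsf{B}x[V]$ for either $\lambda x{:}V$ or $\mathrm{def}(x{=}V)$ and correspondingly $L,x[V]$ for $L,x{:}V$ resp. $L,x{=}V$. One step of bound rt-reduction $L\vdash T_1\to^nT_2$ is the smallest relation closed under: $L\vdash\mathrm{app}(V,\lambda x{:}W.\,T)\to^0\mathrm{def}(x{=}\mathrm{cast}(W,V)).\,T$; $K,x{=}V\vdash x\to^0V$; $L\vdash\mathrm{def}(x{=}V).\,T\to^0T$ if $x$ not free in $T$; $L\vdash\mathrm{app}(V,\mathrm{def}(x{=}W).\,T)\to^0\mathrm{def}(x{=}W).\,\mathrm{app}(V,T)$;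 $L\vdash\mathrm{cast}(U,T)\to^0T$; $L\vdash\star s\to^1\star\,\mathrm{next}(s)$; $K,x{:}W\vdash x\to^1W$; $L\vdash\mathrm{cast}(U,T)\to^1U$; if $K\vdash x\to^nT$, $y\neq x$, $y$ not free in $T$ then $K,y[V]\vdash x\to^nT$; if $L\vdash V_1\to^0V_2$ then $L\vdash\mathrm{app}(V_1,T)\to^0\mathrm{app}(V_2,T)$; if $L\vdash T_1\to^nT_2$ then $L\vdash\mathrm{app}(V,T_1)\to^n\mathrm{app}(V,T_2)$; if $L\vdash V_1\to^0V_2$ then $L\vdash\mathsf Bx[V_1].\,T\to^0\mathsf Bx[V_2].\,T$; if $L,x[V]\vdash T_1\to^nT_2$ then $L\vdash\mathsf Bx[V].\,T_1\to^n\mathsf Bx[V].\,T_2$; if $L\vdash U_1\to^0U_2$ then $L\vdash\mathrm{cast}(U_1,T)\to^0\mathrm{cast}(U_2,T)$; if $L\vdash T_1\to^0T_2$ then $L\vdash\mathrm{cast}(U,T_1)\to^0\mathrm{cast}(U,T_2)$; if $L\vdash U_1\to^1U_2$ and $L\vdash T_1\to^1T_2$ then $L\vdash\mathrm{cast}(U_1,T_1)\to^1\mathrm{cast}(U_2,T_2)$. $L\vdash T_1\to^{*n}T_2$ is the smallest relation with $L\vdash T\to^{*0}T$, containing single steps, and with $L\vdash T_1\to^{*n_1}T$, $L\vdash T\to^{*n_2}T_2$ implying $L\vdash T_1\to^{*n_1+n_2}T_2$. Validity $L\vdash_{\mathcal A}T$ is the smallest predicate closed under: $L\vdash_{\mathcal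 A}\star s$; if $K\vdash_{\mathcal A}V$ then $K,x[V]\vdash_{\mathcal A}x$; if $K\vdash_{\mathcal A}x$ and $y\neq x$ then $K,y[V]\vdash_{\mathcal A}x$; if $L\vdash_{\mathcal A}V$ and $L,x[V]\vdash_{\mathcal A}T$ then $L\vdash_{\mathcal A}\mathsf Bx[V].\,T$; if $L\vdash_{\mathcal A}U$, $L\vdash_{\mathcal A}T$ and some $U_0$ satisfies $L\vdash T\to^{*1}U_0$, $L\vdash U\to^{*0}U_0$, then $L\vdash_{\mathcal A}\mathrm{cast}(U,T)$; if $L\vdash_{\mathcal A}V$, $L\vdash_{\mathcal A}T$ and there are $n\in\mathcal A$, $x,W_0,U_0$ with $L\vdash T\to^{*n}\lambda x{:}W_0.\,U_0$ and $L\vdash V\to^{*1}W_0$, then $L\vdash_{\mathcal A}\mathrm{app}(V,T)$. The type judgment $L\vdash_{\mathcal A}T:U$ means $L\vdash_{\mathcal A}\mathrm{cast}(U,T)$. -}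

module Defs where

open import Data.Nat using (ℕ; zero; suc; _+_; _<ᵇ_)
open import Data.Bool using (if_then_else_)

-- Terms are represented with de Bruijn indices (canonical representatives
-- of terms modulo renaming of bound variables).  The type of sorts is S.

-- The two binders: λx:W (abstraction) and def(x=V) (local definition).
data Bind : Set where
  lam : Bind
  dfn : Bind

data Term (S : Set) : Set where
  sort : S → Term S
  var  : ℕ → Term S
  app  : Term S → Term S → Term S            -- app(V,T): T applied to V
  bind : Bind → Term S → Term S → Term S     -- Bx[V].T  (binds index 0 in T)
  cast : Term S → Term S → Term S

-- Environments: ∅ and  K , b ⟨ V ⟩  (K,x:V if b = lam ; K,x=V if b = dfn)
data Env (S : Set) : Set where
  ∅     : Env S
  _,_⟨_⟩ : Env S → Bind → Term S → Env S

lift : {S : Set} → ℕ → Term S → Term S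
lift c (sort s)     = sort s
lift c (var i)      = if i <ᵇ c then var i else var (suc i)
lift c (app V T)    = app (lift c V) (lift c T)
lift c (bind b W T) = bind b (lift c W) (lift (suc c) T)
lift c (cast U T)   = cast (lift c U) (lift c T)

↑ : {S : Set} → Term S → Term S
↑ = lift 0

module Calculus {S : Set} (next : S → S) where

  data _⊢_⟶[_]_ : Env S → Term S → ℕ → Term S → Set where
    β    : ∀ {L V W T} → L ⊢ app V (bind lam W T) ⟶[ 0 ] bind dfn (cast W V) T
    δ    : ∀ {K V} → (K , dfn ⟨ V ⟩) ⊢ var 0 ⟶[ 0 ] ↑ V
    -- def(x=V).T → T when x not free in T: T is the lift of some T'
    ζ    : ∀ {L V T} → L ⊢ bind dfn V (↑ T) ⟶[ 0 ] T
    θ    : ∀ {L V W T} → L ⊢ app V (bind dfn W T) ⟶[ 0 ] bind dfn W (app (↑ V) T)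
    ε    : ∀ {L U T} → L ⊢ cast U T ⟶[ 0 ] T
    srt  : ∀ {L s} → L ⊢ sort s ⟶[ 1 ] sort (next s)
    ℓ    : ∀ {K W} → (K , lam ⟨ W ⟩) ⊢ var 0 ⟶[ 1 ] ↑ W
    ee   : ∀ {L U T} → L ⊢ cast U T ⟶[ 1 ] U
    lref : ∀ {K i n T b V} → K ⊢ var i ⟶[ n ] T →
           (K , b ⟨ V ⟩) ⊢ var (suc i) ⟶[ n ] ↑ T
    appV : ∀ {L V₁ V₂ T} → L ⊢ V₁ ⟶[ 0 ] V₂ → L ⊢ app V₁ T ⟶[ 0 ] app V₂ T
    appT : ∀ {L V T₁ T₂ n} → L ⊢ T₁ ⟶[ n ] T₂ → L ⊢ app V T₁ ⟶[ n ] app V T₂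
    bndV : ∀ {L b V₁ V₂ T} → L ⊢ V₁ ⟶[ 0 ] V₂ → L ⊢ bind b V₁ T ⟶[ 0 ] bind b V₂ T
    bndT : ∀ {L b V T₁ T₂ n} → (L , b ⟨ V ⟩) ⊢ T₁ ⟶[ n ] T₂ →
           L ⊢ bind b V T₁ ⟶[ n ] bind b V T₂
    cstU : ∀ {L U₁ U₂ T} → L ⊢ U₁ ⟶[ 0 ] U₂ → L ⊢ cast U₁ T ⟶[ 0 ] cast U₂ T
    cstT : ∀ {L U T₁ T₂} → L ⊢ T₁ ⟶[ 0 ] T₂ → L ⊢ cast U T₁ ⟶[ 0 ] cast U T₂
    cst1 : ∀ {L U₁ U₂ T₁ T₂} → L ⊢ U₁ ⟶[ 1 ] U₂ → L ⊢ T₁ ⟶[ 1 ] T₂ →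
           L ⊢ cast U₁ T₁ ⟶[ 1 ] cast U₂ T₂

  data _⊢_⟶*[_]_ : Env S → Term S → ℕ → Term S → Set where
    refl* : ∀ {L T} → L ⊢ T ⟶*[ 0 ] T
    step* : ∀ {L T₁ T₂ n} → L ⊢ T₁ ⟶[ n ] T₂ → L ⊢ T₁ ⟶*[ n ] T₂
    trans* : ∀ {L T₁ T T₂ n₁ n₂} → L ⊢ T₁ ⟶*[ n₁ ] T → L ⊢ T ⟶*[ n₂ ] T₂ →
             L ⊢ T₁ ⟶*[ n₁ + n₂ ] T₂

  data _⊢[_]_ : Env S → (ℕ → Set) → Term S → Set₁ where
    v-sort : ∀ {L A s} → L ⊢[ A ] sort s
    v-var0 : ∀ {K A b V} → K ⊢[ A ] V → (K , b ⟨ V ⟩) ⊢[ A ] var 0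
    v-varS : ∀ {K A b V i} → K ⊢[ A ] var i → (K , b ⟨ V ⟩) ⊢[ A ] var (suc i)
    v-bind : ∀ {L A b V T} → L ⊢[ A ] V → (L , b ⟨ V ⟩) ⊢[ A ] T →
             L ⊢[ A ] bind b V T
    v-cast : ∀ {L A U T U₀} → L ⊢[ A ] U → L ⊢[ A ] T →
             L ⊢ T ⟶*[ 1 ] U₀ → L ⊢ U ⟶*[ 0 ] U₀ → L ⊢[ A ] cast U T
    v-app  : ∀ {L A V T n W₀ U₀} → L ⊢[ A ] V → L ⊢[ A ] T → A n →
             L ⊢ T ⟶*[ n ] bind lam W₀ U₀ → L ⊢ V ⟶*[ 1 ] W₀ →
             L ⊢[ A ] app V T

  _⊢[_]_∶_ : Env S → (ℕ → Set) → Term S → Term S → Set₁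
  L ⊢[ A ] T ∶ U = L ⊢[ A ] cast U T

module Submission where

-- A term T is interpreted, at every level k, by a cast-free and definition-free λ-term ⟦ T ⟧ₖ that
-- stands for the k-fold iterated type of T: a variable x : W is itself at level 0 and W at level
-- k at level k + 1, a definition is substituted, and cast(U,T) is T at level 0 and U at level k at
-- level k + 1.  Abstractions carry all levels of their annotation (up to a bound), so by confluence
-- a redex app(V,λx:W.B) with the domain condition yields ⟦ V ⟧ₖ₊₁ ≃ ⟦ W ⟧ₖ for all k.  Hence, in
-- a term whose casts and applications satisfy the corresponding conditions up to conversion,
-- T →ⁿ T′ implies ⟦ T ⟧ₙ₊ₖ ≃ ⟦ T′ ⟧ₖ, and these conditions are preserved: no induction
-- on a well-founded order mixing reduction and typing is needed.  Valid terms satisfy them and have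
-- simply typed, thus normalising, interpretations, and T itself reduces to the level n interpretation
-- in n type steps.  So the premises of cast and app can be decided by comparing normal forms.  For app,
-- level n of T is convertible to an abstraction for every large n if this happens at all, because
-- at large levels the spine of ⟦ T ⟧ₙ ends in a sort, and from then on its domain does not change;
-- therefore only the least such n has to be compared with 𝒜.

open import Defs
open import Data.Bool using (if_then_else_; true; false)
open import Data.Empty using (⊥; ⊥-elim)
open import Data.Nat using (ℕ; zero; suc; _+_; _⊔_; _≤_; z≤n; s≤s; _<ᵇ_)
open import Data.Nat.Properties
  using (≤-refl; ≤-trans; m≤m⊔n; m≤n⊔m; m≤n+m; m≤n⇒∃[o]m+o≡n;
         +-assoc; +-comm; +-identityʳ; m+n≡0⇒m≡0; m+n≡0⇒n≡0)
  renaming (_≟_ to _≟ℕ_)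
open import Data.Product using (∃-syntax; _×_; _,_; proj₁; proj₂)
open import Data.Unit using (⊤; tt)
open import Function using (_∘_)
open import Relation.Binary.Construct.Closure.ReflexiveTransitive
  using (Star; _◅_; _◅◅_; gmap) renaming (ε to [])
open import Relation.Binary.Definitions using (DecidableEquality)
open import Relation.Binary.PropositionalEquality
  using (_≡_; refl; sym; trans; cong; cong₂; subst; subst₂; _≗_)
open import Relation.Nullary using (¬_; Dec; yes; no)
open import Relation.Nullary.Decidable using (map′; _×-dec_)

-- Plain λ-terms, renaming and substitution.

infixr 5 _▹_

_▹_ : ∀ {a} {X : Set a} → X → (ℕ → X) → ℕ → X
(x ▹ f) zero    = x
(x ▹ f) (suc i) = f i

data Kind : Set where
  tm ls : Kind

-- λ-terms without casts and definitions.  An annotation is a nonempty list: the annotation itself,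
-- its type, the type of its type, and so on.
data Plain (S : Set) : Kind → Set where
  srt : S → Plain S tm
  var : ℕ → Plain S tm
  app : Plain S tm → Plain S tm → Plain S tm
  lam : Plain S ls → Plain S tm → Plain S tm
  one : Plain S tm → Plain S ls
  _∷_ : Plain S tm → Plain S ls → Plain S ls

extᵣ : (ℕ → ℕ) → ℕ → ℕ
extᵣ ξ = zero ▹ (suc ∘ ξ)

data Ty : Set where
  ι   : Ty
  _⇒_ : Ty → Ty → Ty

variable
  κ : Kind
  ξ ξ′ : ℕ → ℕ
  a a′ c : Ty
  Γ Δ : ℕ → Ty

module _ {S : Set} where

  private
    P : Kind → Set
    P = Plain S

  variable
    M M′ N V V′ b b′ : Plain S tm
    As As′ : Plain S ls
    X X′ Y Z : Plain S κ
    σ τ : ℕ → Plain S tm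

  ren : (ℕ → ℕ) → P κ → P κ
  ren ξ (srt s)   = srt s
  ren ξ (var i)   = var (ξ i)
  ren ξ (app V M) = app (ren ξ V) (ren ξ M)
  ren ξ (lam A b) = lam (ren ξ A) (ren (extᵣ ξ) b)
  ren ξ (one M)   = one (ren ξ M)
  ren ξ (M ∷ A)   = ren ξ M ∷ ren ξ A

  exts : (ℕ → P tm) → ℕ → P tm
  exts σ = var 0 ▹ (ren suc ∘ σ)

  sub : (ℕ → P tm) → P κ → P κ
  sub σ (srt s)   = srt s
  sub σ (var i)   = σ i
  sub σ (app V M) = app (sub σ V) (sub σ M)
  sub σ (lam A b) = lam (sub σ A) (sub (exts σ) b)
  sub σ (one M)   = one (sub σ M)
  sub σ (M ∷ A)   = sub σ M ∷ sub σ A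

  ren-cong : ξ ≗ ξ′ → (X : P κ) → ren ξ X ≡ ren ξ′ X
  ren-cong e (srt s)   = refl
  ren-cong e (var i)   = cong var (e i)
  ren-cong e (app V M) = cong₂ app (ren-cong e V) (ren-cong e M)
  ren-cong e (lam A b) = cong₂ lam (ren-cong e A)
    (ren-cong (λ { zero → refl ; (suc i) → cong suc (e i) }) b)
  ren-cong e (one M)   = cong one (ren-cong e M)
  ren-cong e (M ∷ A)   = cong₂ _∷_ (ren-cong e M) (ren-cong e A)

  sub-cong : σ ≗ τ → (X : P κ) → sub σ X ≡ sub τ X
  sub-cong e (srt s)   = refl
  sub-cong e (var i)   = e i
  sub-cong e (app V M) = cong₂ app (sub-cong e V) (sub-cong e M)
  sub-cong e (lam A b) = cong₂ lam (sub-cong e A)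
    (sub-cong (λ { zero → refl ; (suc i) → cong (ren suc) (e i) }) b)
  sub-cong e (one M)   = cong one (sub-cong e M)
  sub-cong e (M ∷ A)   = cong₂ _∷_ (sub-cong e M) (sub-cong e A)

  ren-ren : (X : P κ) → ren ξ′ (ren ξ X) ≡ ren (ξ′ ∘ ξ) X
  ren-ren (srt s)   = refl
  ren-ren (var i)   = refl
  ren-ren (app V M) = cong₂ app (ren-ren V) (ren-ren M)
  ren-ren (lam A b) = cong₂ lam (ren-ren A)
    (trans (ren-ren b) (ren-cong (λ { zero → refl ; (suc i) → refl }) b))
  ren-ren (one M)   = cong one (ren-ren M)
  ren-ren (M ∷ A)   = cong₂ _∷_ (ren-ren M) (ren-ren A)

  sub-ren : (X : P κ) → sub σ (ren ξ X) ≡ sub (σ ∘ ξ) X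
  sub-ren (srt s)   = refl
  sub-ren (var i)   = refl
  sub-ren (app V M) = cong₂ app (sub-ren V) (sub-ren M)
  sub-ren (lam A b) = cong₂ lam (sub-ren A)
    (trans (sub-ren b) (sub-cong (λ { zero → refl ; (suc i) → refl }) b))
  sub-ren (one M)   = cong one (sub-ren M)
  sub-ren (M ∷ A)   = cong₂ _∷_ (sub-ren M) (sub-ren A)

  ren-sub : (X : P κ) → ren ξ (sub σ X) ≡ sub (ren ξ ∘ σ) X
  ren-sub (srt s)   = refl
  ren-sub (var i)   = refl
  ren-sub (app V M) = cong₂ app (ren-sub V) (ren-sub M)
  ren-sub {σ = σ} (lam A b) = cong₂ lam (ren-sub A)
    (trans (ren-sub b) (sub-cong
      (λ { zero → refl ; (suc i) → trans (ren-ren (σ i)) (sym (ren-ren (σ i))) }) b))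
  ren-sub (one M)   = cong one (ren-sub M)
  ren-sub (M ∷ A)   = cong₂ _∷_ (ren-sub M) (ren-sub A)

  sub-exts-↑ : (X : P κ) → sub (exts σ) (ren suc X) ≡ ren suc (sub σ X)
  sub-exts-↑ X = trans (sub-ren X) (sym (ren-sub X))

  sub-sub : (X : P κ) → sub τ (sub σ X) ≡ sub (sub τ ∘ σ) X
  sub-sub (srt s)   = refl
  sub-sub (var i)   = refl
  sub-sub (app V M) = cong₂ app (sub-sub V) (sub-sub M)
  sub-sub {σ = σ} (lam A b) = cong₂ lam (sub-sub A)
    (trans (sub-sub b) (sub-cong (λ { zero → refl ; (suc i) → sub-exts-↑ (σ i) }) b))
  sub-sub (one M)   = cong one (sub-sub M)
  sub-sub (M ∷ A)   = cong₂ _∷_ (sub-sub M) (sub-sub A)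

  sub-var : (X : P κ) → sub var X ≡ X
  sub-var (srt s)   = refl
  sub-var (var i)   = refl
  sub-var (app V M) = cong₂ app (sub-var V) (sub-var M)
  sub-var (lam A b) = cong₂ lam (sub-var A)
    (trans (sub-cong (λ { zero → refl ; (suc i) → refl }) b) (sub-var b))
  sub-var (one M)   = cong one (sub-var M)
  sub-var (M ∷ A)   = cong₂ _∷_ (sub-var M) (sub-var A)

  sub-▹-↑-var : (X : P κ) → sub (V ▹ var) (ren suc X) ≡ X
  sub-▹-↑-var X = trans (sub-ren X) (sub-var X)

  ren-is-sub : (X : P κ) → sub (var ∘ ξ) X ≡ ren ξ X
  ren-is-sub X = trans (sym (sub-ren X)) (sub-var _)

  ren-instantiate : (b : P tm) → ren ξ (sub (V ▹ var) b) ≡ sub (ren ξ V ▹ var) (ren (extᵣ ξ) b)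
  ren-instantiate b = trans (ren-sub b)
    (trans (sub-cong (λ { zero → refl ; (suc i) → refl }) b) (sym (sub-ren b)))

  sub-instantiate : (b : P tm) → sub σ (sub (V ▹ var) b) ≡ sub (sub σ V ▹ var) (sub (exts σ) b)
  sub-instantiate {σ = σ} b = trans (sub-sub b)
    (trans (sub-cong (λ { zero → refl ; (suc i) → sym (sub-▹-↑-var (σ i)) }) b) (sym (sub-sub b)))

  -- Parallel reduction, confluence and conversion.

  infix 4 _⇛_ _⇛*_ _≃_

  data _⇛_ : P κ → P κ → Set where
    srt : ∀ {s} → srt s ⇛ srt s
    var : ∀ {i} → var i ⇛ var i
    app : V ⇛ V′ → M ⇛ M′ → app V M ⇛ app V′ M′
    lam : As ⇛ As′ → b ⇛ b′ → lam As b ⇛ lam As′ b′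
    one : M ⇛ M′ → one M ⇛ one M′
    _∷_ : M ⇛ M′ → As ⇛ As′ → (M ∷ As) ⇛ (M′ ∷ As′)
    β   : V ⇛ V′ → b ⇛ b′ → app V (lam As b) ⇛ sub (V′ ▹ var) b′

  ⇛-refl : (X : P κ) → X ⇛ X
  ⇛-refl (srt s)   = srt
  ⇛-refl (var i)   = var
  ⇛-refl (app V M) = app (⇛-refl V) (⇛-refl M)
  ⇛-refl (lam A b) = lam (⇛-refl A) (⇛-refl b)
  ⇛-refl (one M)   = one (⇛-refl M)
  ⇛-refl (M ∷ A)   = ⇛-refl M ∷ ⇛-refl A

  ⇛-ren : X ⇛ X′ → ren ξ X ⇛ ren ξ X′
  ⇛-ren srt       = srt
  ⇛-ren var       = var
  ⇛-ren (app v m) = app (⇛-ren v) (⇛-ren m)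
  ⇛-ren (lam a m) = lam (⇛-ren a) (⇛-ren m)
  ⇛-ren (one m)   = one (⇛-ren m)
  ⇛-ren (m ∷ a)   = ⇛-ren m ∷ ⇛-ren a
  ⇛-ren (β {b′ = b′} v m) = subst (_ ⇛_) (sym (ren-instantiate b′)) (β (⇛-ren v) (⇛-ren m))

  exts-⇛ : (∀ i → σ i ⇛ τ i) → ∀ i → exts σ i ⇛ exts τ i
  exts-⇛ s zero    = var
  exts-⇛ s (suc i) = ⇛-ren (s i)

  ⇛-sub : (∀ i → σ i ⇛ τ i) → X ⇛ X′ → sub σ X ⇛ sub τ X′
  ⇛-sub s srt       = srt
  ⇛-sub s var       = s _
  ⇛-sub s (app v m) = app (⇛-sub s v) (⇛-sub s m)
  ⇛-sub s (lam a m) = lam (⇛-sub s a) (⇛-sub (exts-⇛ s) m)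
  ⇛-sub s (one m)   = one (⇛-sub s m)
  ⇛-sub s (m ∷ a)   = ⇛-sub s m ∷ ⇛-sub s a
  ⇛-sub s (β {b′ = b′} v m) =
    subst (_ ⇛_) (sym (sub-instantiate b′)) (β (⇛-sub s v) (⇛-sub (exts-⇛ s) m))

  instantiate-⇛ : V ⇛ V′ → b ⇛ b′ → sub (V ▹ var) b ⇛ sub (V′ ▹ var) b′
  instantiate-⇛ v m = ⇛-sub (λ { zero → v ; (suc i) → var }) m

  -- Takahashi's complete development: it contracts all redexes of a term at once, so by `⇛-dev` it
  -- is a common one-step target of all one-step reducts.
  dev : P κ → P κ
  dev (srt s)           = srt s
  dev (var i)           = var i
  dev (app V (lam A b)) = sub (dev V ▹ var) (dev b)
  dev (app V M)         = app (dev V) (dev M)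
  dev (lam A b)         = lam (dev A) (dev b)
  dev (one M)           = one (dev M)
  dev (M ∷ A)           = dev M ∷ dev A

  ⇛-dev : X ⇛ Y → Y ⇛ dev X
  ⇛-dev srt = srt
  ⇛-dev var = var
  ⇛-dev (app {M = srt s} v m)           = app (⇛-dev v) (⇛-dev m)
  ⇛-dev (app {M = var i} v m)           = app (⇛-dev v) (⇛-dev m)
  ⇛-dev (app {M = app _ _} v m)         = app (⇛-dev v) (⇛-dev m)
  ⇛-dev (app {M = lam _ _} v (lam a m)) = β (⇛-dev v) (⇛-dev m)
  ⇛-dev (lam a m) = lam (⇛-dev a) (⇛-dev m)
  ⇛-dev (one m)   = one (⇛-dev m)
  ⇛-dev (m ∷ a)   = ⇛-dev m ∷ ⇛-dev a
  ⇛-dev (β v m)   = instantiate-⇛ (⇛-dev v) (⇛-dev m)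

  _⇛*_ : P κ → P κ → Set
  _⇛*_ = Star _⇛_

  _≃_ : P κ → P κ → Set
  X ≃ Y = ∃[ Z ] (X ⇛* Z × Y ⇛* Z)

  strip : X ⇛ Y → X ⇛* Z → ∃[ U ] (Y ⇛* U × Z ⇛ U)
  strip r []       = _ , [] , r
  strip r (s ◅ ss) with strip (⇛-dev s) ss
  ... | U , t , u = U , ⇛-dev r ◅ t , u

  confluence : X ⇛* Y → X ⇛* Z → Y ≃ Z
  confluence []       s = _ , s , []
  confluence (r ◅ rs) s with strip r s
  ... | U , t , u with confluence rs t
  ... | W , v , w = W , v , u ◅ w

  ≃-refl : X ≃ X
  ≃-refl = _ , [] , []

  ≃-sym : X ≃ Y → Y ≃ X
  ≃-sym (Z , p , q) = Z , q , p

  ≃-trans : X ≃ Y → Y ≃ Z → X ≃ Z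
  ≃-trans (_ , p , q) (_ , r , s) with confluence q r
  ... | U , t , u = U , p ◅◅ t , s ◅◅ u

  ≡⇒≃ : X ≡ Y → X ≃ Y
  ≡⇒≃ refl = ≃-refl

  ⇛*⇒≃ : X ⇛* Y → X ≃ Y
  ⇛*⇒≃ r = _ , r , []

  app-⇛* : V ⇛* V′ → M ⇛* M′ → app V M ⇛* app V′ M′
  app-⇛* v m = gmap (λ V → app V _) (λ r → app r (⇛-refl _)) v ◅◅ gmap (app _) (app (⇛-refl _)) m

  lam-⇛* : As ⇛* As′ → b ⇛* b′ → lam As b ⇛* lam As′ b′
  lam-⇛* a m = gmap (λ A → lam A _) (λ r → lam r (⇛-refl _)) a ◅◅ gmap (lam _) (lam (⇛-refl _)) m

  one-⇛* : M ⇛* M′ → one M ⇛* one M′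
  one-⇛* = gmap one one

  ∷-⇛* : M ⇛* M′ → As ⇛* As′ → (M ∷ As) ⇛* (M′ ∷ As′)
  ∷-⇛* m a = gmap (_∷ _) (_∷ ⇛-refl _) m ◅◅ gmap (_ ∷_) (⇛-refl _ ∷_) a

  app-≃ : V ≃ V′ → M ≃ M′ → app V M ≃ app V′ M′
  app-≃ (_ , p , q) (_ , r , s) = _ , app-⇛* p r , app-⇛* q s

  lam-≃ : As ≃ As′ → b ≃ b′ → lam As b ≃ lam As′ b′
  lam-≃ (_ , p , q) (_ , r , s) = _ , lam-⇛* p r , lam-⇛* q s

  one-≃ : M ≃ M′ → one M ≃ one M′
  one-≃ (_ , p , q) = _ , one-⇛* p , one-⇛* q

  ∷-≃ : M ≃ M′ → As ≃ As′ → (M ∷ As) ≃ (M′ ∷ As′)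
  ∷-≃ (_ , p , q) (_ , r , s) = _ , ∷-⇛* p r , ∷-⇛* q s

  sub-≃ : X ≃ Y → sub σ X ≃ sub σ Y
  sub-≃ (_ , p , q) = _ , gmap _ (⇛-sub λ i → ⇛-refl _) p , gmap _ (⇛-sub λ i → ⇛-refl _) q

  ren-≃ : X ≃ Y → ren ξ X ≃ ren ξ Y
  ren-≃ (_ , p , q) = _ , gmap _ ⇛-ren p , gmap _ ⇛-ren q

  β-≃ : app V (lam As b) ≃ sub (V ▹ var) b
  β-≃ = ⇛*⇒≃ (β (⇛-refl _) (⇛-refl _) ◅ [])

  lam-⇛*-inv : lam As b ⇛* N → ∃[ As′ ] ∃[ b′ ] (N ≡ lam As′ b′ × As ⇛* As′ × b ⇛* b′)
  lam-⇛*-inv [] = _ , _ , refl , [] , []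
  lam-⇛*-inv (lam a m ◅ rs) with lam-⇛*-inv rs
  ... | _ , _ , e , a* , m* = _ , _ , e , a ◅ a* , m ◅ m*

  one-⇛*-inv : one M ⇛* As → ∃[ M′ ] (As ≡ one M′ × M ⇛* M′)
  one-⇛*-inv [] = _ , refl , []
  one-⇛*-inv (one m ◅ rs) with one-⇛*-inv rs
  ... | _ , e , m* = _ , e , m ◅ m*

  ∷-⇛*-inv : (M ∷ As) ⇛* X → ∃[ M′ ] ∃[ As′ ] (X ≡ M′ ∷ As′ × M ⇛* M′ × As ⇛* As′)
  ∷-⇛*-inv [] = _ , _ , refl , [] , []
  ∷-⇛*-inv ((m ∷ a) ◅ rs) with ∷-⇛*-inv rs
  ... | _ , _ , e , m* , a* = _ , _ , e , m ◅ m* , a ◅ a*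

  lam-injectiveˡ : lam As b ≃ lam As′ b′ → As ≃ As′
  lam-injectiveˡ (_ , p , q) with lam-⇛*-inv p | lam-⇛*-inv q
  ... | _ , _ , refl , a , _ | _ , _ , refl , a′ , _ = _ , a , a′

  one-injective : one M ≃ one M′ → M ≃ M′
  one-injective (_ , p , q) with one-⇛*-inv p | one-⇛*-inv q
  ... | _ , refl , m | _ , refl , m′ = _ , m , m′

  ∷-injective : (M ∷ As) ≃ (M′ ∷ As′) → M ≃ M′ × As ≃ As′
  ∷-injective (_ , p , q) with ∷-⇛*-inv p | ∷-⇛*-inv q
  ... | _ , _ , refl , m , a | _ , _ , refl , m′ , a′ = (_ , m , m′) , (_ , a , a′)

  -- Annotations as lists of levels, and their truncation.

  lst : ℕ → (ℕ → P tm) → P ls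
  lst zero    f = one (f 0)
  lst (suc n) f = f 0 ∷ lst n (f ∘ suc)

  sub-lst-≃ : ∀ n {f g} → (∀ k → sub σ (f k) ≃ g k) → sub σ (lst n f) ≃ lst n g
  sub-lst-≃ zero    e = one-≃ (e 0)
  sub-lst-≃ (suc n) e = ∷-≃ (e 0) (sub-lst-≃ n (e ∘ suc))

  lst-≃ : ∀ n {f g} → (∀ k → f k ≃ g k) → lst n f ≃ lst n g
  lst-≃ zero    e = one-≃ (e 0)
  lst-≃ (suc n) e = ∷-≃ (e 0) (lst-≃ n (e ∘ suc))

  lst-injective : ∀ n {f g} → lst n f ≃ lst n g → ∀ {k} → k ≤ n → f k ≃ g k
  lst-injective zero    e z≤n     = one-injective e
  lst-injective (suc n) e z≤n     = proj₁ (∷-injective e)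
  lst-injective (suc n) e (s≤s l) = lst-injective n (proj₂ (∷-injective e)) l

  -- truncate n c keeps n + 1 entries of every annotation, except that a list at the root keeps
  -- c + 1 entries; c carries no information for terms.
  Count : Kind → Set
  Count tm = ⊤
  Count ls = ℕ

  truncate : ℕ → Count κ → P κ → P κ
  truncate n c (srt s)       = srt s
  truncate n c (var i)       = var i
  truncate n c (app V M)     = app (truncate n tt V) (truncate n tt M)
  truncate n c (lam A b)     = lam (truncate n n A) (truncate n tt b)
  truncate n c (one M)       = one (truncate n tt M)
  truncate n zero (M ∷ A)    = one (truncate n tt M)
  truncate n (suc c) (M ∷ A) = truncate n tt M ∷ truncate n c A

  truncate-ren : ∀ n c (X : P κ) → truncate n c (ren ξ X) ≡ ren ξ (truncate n c X)
  truncate-ren n c (srt s)       = refl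
  truncate-ren n c (var i)       = refl
  truncate-ren n c (app V M)     = cong₂ app (truncate-ren n tt V) (truncate-ren n tt M)
  truncate-ren n c (lam A b)     = cong₂ lam (truncate-ren n n A) (truncate-ren n tt b)
  truncate-ren n c (one M)       = cong one (truncate-ren n tt M)
  truncate-ren n zero (M ∷ A)    = cong one (truncate-ren n tt M)
  truncate-ren n (suc c) (M ∷ A) = cong₂ _∷_ (truncate-ren n tt M) (truncate-ren n c A)

  truncate-sub : ∀ n c (X : P κ) → truncate n c (sub σ X) ≡ sub (truncate n tt ∘ σ) (truncate n c X)
  truncate-sub n c (srt s)       = refl
  truncate-sub n c (var i)       = refl
  truncate-sub n c (app V M)     = cong₂ app (truncate-sub n tt V) (truncate-sub n tt M)
  truncate-sub {σ = σ} n c (lam A b) = cong₂ lam (truncate-sub n n A)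
    (trans (truncate-sub n tt b)
      (sub-cong (λ { zero → refl ; (suc i) → truncate-ren n tt (σ i) }) (truncate n tt b)))
  truncate-sub n c (one M)       = cong one (truncate-sub n tt M)
  truncate-sub n zero (M ∷ A)    = cong one (truncate-sub n tt M)
  truncate-sub n (suc c) (M ∷ A) = cong₂ _∷_ (truncate-sub n tt M) (truncate-sub n c A)

  -- Truncation changes annotations only, and contracting a redex discards its annotation without
  -- looking at it.
  truncate-⇛ : ∀ n c → X ⇛ Y → truncate n c X ⇛ truncate n c Y
  truncate-⇛ n c srt           = srt
  truncate-⇛ n c var           = var
  truncate-⇛ n c (app v m)     = app (truncate-⇛ n tt v) (truncate-⇛ n tt m)
  truncate-⇛ n c (lam a m)     = lam (truncate-⇛ n n a) (truncate-⇛ n tt m)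
  truncate-⇛ n c (one m)       = one (truncate-⇛ n tt m)
  truncate-⇛ n zero (m ∷ a)    = one (truncate-⇛ n tt m)
  truncate-⇛ n (suc c) (m ∷ a) = truncate-⇛ n tt m ∷ truncate-⇛ n c a
  truncate-⇛ n c (β {b′ = b′} v m) =
    subst (_ ⇛_)
      (trans (sub-cong (λ { zero → refl ; (suc i) → refl }) (truncate n tt b′))
        (sym (truncate-sub n tt b′)))
      (β (truncate-⇛ n tt v) (truncate-⇛ n tt m))

  truncate-≃ : ∀ n → M ≃ N → truncate n tt M ≃ truncate n tt N
  truncate-≃ n (_ , p , q) = _ , gmap _ (truncate-⇛ n tt) p , gmap _ (truncate-⇛ n tt) q

  truncate-lst : ∀ n {c m f g} → c ≤ m → (∀ k → truncate n tt (f k) ≡ g k) →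
                 truncate n c (lst m f) ≡ lst c g
  truncate-lst n {m = zero}  z≤n     e = cong one (e 0)
  truncate-lst n {m = suc m} z≤n     e = cong one (e 0)
  truncate-lst n {m = suc m} (s≤s l) e = cong₂ _∷_ (e 0) (truncate-lst n l (e ∘ suc))

  -- Simple types.

  infix 4 _⊩_∶_

  -- A term and its iterated types share one simple type: every entry of an annotation gets the type
  -- of the variable that it annotates.
  data _⊩_∶_ : (ℕ → Ty) → P κ → Ty → Set where
    srt : ∀ {s} → Γ ⊩ srt s ∶ ι
    var : ∀ {i} → Γ i ≡ a → Γ ⊩ var i ∶ a
    app : Γ ⊩ V ∶ a → Γ ⊩ M ∶ a ⇒ c → Γ ⊩ app V M ∶ c
    lam : Γ ⊩ As ∶ a → a ▹ Γ ⊩ b ∶ c → Γ ⊩ lam As b ∶ a ⇒ c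
    one : Γ ⊩ M ∶ a → Γ ⊩ one M ∶ a
    _∷_ : Γ ⊩ M ∶ a → Γ ⊩ As ∶ a → Γ ⊩ M ∷ As ∶ a

  ⊩-unique : Γ ⊩ X ∶ a → Γ ⊩ X ∶ a′ → a ≡ a′
  ⊩-unique srt       srt         = refl
  ⊩-unique (var p)   (var q)     = trans (sym p) q
  ⊩-unique (app v m) (app v′ m′) with refl ← ⊩-unique m m′ = refl
  ⊩-unique (lam a m) (lam a′ m′) with refl ← ⊩-unique a a′ with refl ← ⊩-unique m m′ = refl
  ⊩-unique (one m)   (one m′)    = ⊩-unique m m′
  ⊩-unique (m ∷ _)   (m′ ∷ _)    = ⊩-unique m m′

  ⊩-annotation : Γ ⊩ lam As b ∶ a → ∃[ a′ ] (Γ ⊩ As ∶ a′)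
  ⊩-annotation (lam t _) = _ , t

  ⊩-ren : (∀ i → Δ (ξ i) ≡ Γ i) → Γ ⊩ X ∶ a → Δ ⊩ ren ξ X ∶ a
  ⊩-ren e srt       = srt
  ⊩-ren e (var p)   = var (trans (e _) p)
  ⊩-ren e (app v m) = app (⊩-ren e v) (⊩-ren e m)
  ⊩-ren e (lam a m) = lam (⊩-ren e a) (⊩-ren (λ { zero → refl ; (suc i) → e i }) m)
  ⊩-ren e (one m)   = one (⊩-ren e m)
  ⊩-ren e (m ∷ a)   = ⊩-ren e m ∷ ⊩-ren e a

  ⊩-↑ : Γ ⊩ X ∶ a → a′ ▹ Γ ⊩ ren suc X ∶ a
  ⊩-↑ = ⊩-ren λ _ → refl

  ⊩-sub : (∀ i → Δ ⊩ σ i ∶ Γ i) → Γ ⊩ X ∶ a → Δ ⊩ sub σ X ∶ a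
  ⊩-sub e srt        = srt
  ⊩-sub e (var refl) = e _
  ⊩-sub e (app v m)  = app (⊩-sub e v) (⊩-sub e m)
  ⊩-sub e (lam a m)  = lam (⊩-sub e a)
    (⊩-sub (λ { zero → var refl ; (suc i) → ⊩-↑ (e i) }) m)
  ⊩-sub e (one m)    = one (⊩-sub e m)
  ⊩-sub e (m ∷ a)    = ⊩-sub e m ∷ ⊩-sub e a

  ⊩-⇛ : X ⇛ Y → Γ ⊩ X ∶ a → Γ ⊩ Y ∶ a
  ⊩-⇛ srt       srt       = srt
  ⊩-⇛ var       t         = t
  ⊩-⇛ (app v m) (app s t) = app (⊩-⇛ v s) (⊩-⇛ m t)
  ⊩-⇛ (lam a m) (lam s t) = lam (⊩-⇛ a s) (⊩-⇛ m t)
  ⊩-⇛ (one m)   (one t)   = one (⊩-⇛ m t)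
  ⊩-⇛ (m ∷ a)   (s ∷ t)   = ⊩-⇛ m s ∷ ⊩-⇛ a t
  ⊩-⇛ (β v m)   (app s (lam _ t)) =
    ⊩-sub (λ { zero → ⊩-⇛ v s ; (suc i) → var refl }) (⊩-⇛ m t)

  ⊩-⇛* : X ⇛* Y → Γ ⊩ X ∶ a → Γ ⊩ Y ∶ a
  ⊩-⇛* []       t = t
  ⊩-⇛* (r ◅ rs) t = ⊩-⇛* rs (⊩-⇛ r t)

  ≃-same-type : X ≃ Y → Γ ⊩ X ∶ a → Γ ⊩ Y ∶ a′ → a ≡ a′
  ≃-same-type (_ , p , q) s t = ⊩-unique (⊩-⇛* p s) (⊩-⇛* q t)

  -- Normal forms and weak normalisation.

  mutual
    data Neutral : P tm → Set where
      srt : ∀ {s} → Neutral (srt s)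
      var : ∀ {i} → Neutral (var i)
      app : Normal V → Neutral M → Neutral (app V M)

    data Normal : P κ → Set where
      neutral : Neutral M → Normal M
      lam     : Normal As → Normal b → Normal (lam As b)
      one     : Normal M → Normal (one M)
      _∷_     : Normal M → Normal As → Normal (M ∷ As)

  mutual
    neutral-⇛ : Neutral M → M ⇛ N → N ≡ M
    neutral-⇛ srt       srt         = refl
    neutral-⇛ var       var         = refl
    neutral-⇛ (app v m) (app v′ m′) = cong₂ app (normal-⇛ v v′) (neutral-⇛ m m′)

    normal-⇛ : Normal X → X ⇛ Y → Y ≡ X
    normal-⇛ (neutral m) r         = neutral-⇛ m r
    normal-⇛ (lam a m)   (lam r s) = cong₂ lam (normal-⇛ a r) (normal-⇛ m s)
    normal-⇛ (one m)     (one r)   = cong one (normal-⇛ m r)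
    normal-⇛ (m ∷ a)     (r ∷ s)   = cong₂ _∷_ (normal-⇛ m r) (normal-⇛ a s)

  normal-⇛* : Normal X → X ⇛* Y → Y ≡ X
  normal-⇛* n []       = refl
  normal-⇛* n (r ◅ rs) with refl ← normal-⇛ n r = normal-⇛* n rs

  normal-≃ : Normal X → Normal Y → X ≃ Y → X ≡ Y
  normal-≃ m n (_ , p , q) = trans (sym (normal-⇛* m p)) (normal-⇛* n q)

  mutual
    neutral-ren : Neutral M → Neutral (ren ξ M)
    neutral-ren srt       = srt
    neutral-ren var       = var
    neutral-ren (app v m) = app (normal-ren v) (neutral-ren m)

    normal-ren : Normal X → Normal (ren ξ X)
    normal-ren (neutral m) = neutral (neutral-ren m)
    normal-ren (lam a m)   = lam (normal-ren a) (normal-ren m)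
    normal-ren (one m)     = one (normal-ren m)
    normal-ren (m ∷ a)     = normal-ren m ∷ normal-ren a

  WN : P κ → Set
  WN X = ∃[ Y ] (X ⇛* Y × Normal Y)

  -- Tait's reducibility in Kripke style; the quantification over renamings makes it stable under
  -- `ren`, as needed below binders.
  Reducible : Ty → P tm → Set
  Reducible ι       M = WN M
  Reducible (a ⇒ c) M = WN M × (∀ ξ V → Reducible a V → Reducible c (app V (ren ξ M)))

  reducible-WN : ∀ a → Reducible a M → WN M
  reducible-WN ι       r = r
  reducible-WN (a ⇒ c) r = proj₁ r

  -- Stated for terms that reduce to a neutral one, because `app V M` with a reducible argument `V`
  -- becomes neutral only after `V` is normalised.
  neutral-reducible : ∀ a → M ⇛* N → Neutral N → Reducible a M
  neutral-reducible ι       r n = _ , r , neutral n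
  neutral-reducible (a ⇒ c) r n = (_ , r , neutral n) , λ ξ V v →
    let _ , s , m = reducible-WN a v in
    neutral-reducible c (app-⇛* s (gmap (ren ξ) ⇛-ren r)) (app m (neutral-ren n))

  reducible-ren : ∀ a → Reducible a M → Reducible a (ren ξ M)
  reducible-ren ι       (_ , r , n) = _ , gmap _ ⇛-ren r , normal-ren n
  reducible-ren {M = M} (a ⇒ c) ((_ , r , n) , f) =
    (_ , gmap _ ⇛-ren r , normal-ren n) ,
    λ ξ′ V v → subst (Reducible c ∘ app V) (sym (ren-ren M)) (f _ V v)

  -- Any parallel step may be undone, not just a head step, since the predicate asks only for weak
  -- normalisation.
  reducible-expansion : ∀ a → M ⇛ N → Reducible a N → Reducible a M
  reducible-expansion ι       r (_ , rs , n) = _ , r ◅ rs , n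
  reducible-expansion (a ⇒ c) r ((_ , rs , n) , f) =
    (_ , r ◅ rs , n) ,
    λ ξ′ V v → reducible-expansion c (app (⇛-refl V) (⇛-ren r)) (f ξ′ V v)

  ReducibleK : ∀ κ → Ty → P κ → Set
  ReducibleK tm = Reducible
  ReducibleK ls _ = WN

  fundamental : Γ ⊩ X ∶ a → (∀ i → Reducible (Γ i) (σ i)) → ReducibleK κ a (sub σ X)
  fundamental srt        e = neutral-reducible ι [] srt
  fundamental (var refl) e = e _
  fundamental {σ = σ} (app {M = M} v m) e =
    subst (Reducible _ ∘ app _) (ren-id (sub σ M))
      (proj₂ (fundamental m e) (λ i → i) _ (fundamental v e))
    where
    ren-id : (X : P κ) → ren (λ i → i) X ≡ X
    ren-id X = trans (sym (ren-is-sub X)) (sub-var X)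
  fundamental {σ = σ} (lam {a = a} {b = b} {c = c} t m) e =
    (let _ , r , n = fundamental t e
         _ , s , k = reducible-WN c (fundamental m λ
           { zero → neutral-reducible a [] var ; (suc i) → reducible-ren _ (e i) })
     in _ , lam-⇛* r s , lam n k) ,
    λ ξ V v → reducible-expansion c
      (subst (app V (ren ξ (lam _ (sub (exts σ) b))) ⇛_) (eq ξ V) (β (⇛-refl V) (⇛-refl _)))
      (fundamental m λ { zero → v ; (suc i) → reducible-ren _ (e i) })
    where
    eq : ∀ ξ V → sub (V ▹ var) (ren (extᵣ ξ) (sub (exts σ) b)) ≡ sub (V ▹ (ren ξ ∘ σ)) b
    eq ξ V = trans (sub-ren (sub (exts σ) b)) (trans (sub-sub b) (sub-cong
      (λ { zero → refl ; (suc i) → trans (sub-ren (σ i)) (ren-is-sub (σ i)) }) b))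
  fundamental (one {a = a} m) e =
    let _ , r , n = reducible-WN a (fundamental m e) in _ , one-⇛* r , one n
  fundamental (_∷_ {a = a} m t) e =
    let _ , r , n = reducible-WN a (fundamental m e)
        _ , s , k = fundamental t e
    in _ , ∷-⇛* r s , n ∷ k

  ReducibleK-WN : ∀ κ {X : P κ} → ReducibleK κ a X → WN X
  ReducibleK-WN tm r = reducible-WN _ r
  ReducibleK-WN ls r = r

  normalisation : Γ ⊩ X ∶ a → WN X
  normalisation {X = X} t =
    subst WN (sub-var X) (ReducibleK-WN _ (fundamental t λ i → neutral-reducible _ [] var))

  -- Decidability of conversion by comparing normal forms.

  module _ (_≟_ : DecidableEquality S) where

    _≡?_ : (X Y : P κ) → Dec (X ≡ Y)
    srt s   ≡? srt s′    = map′ (cong srt) (λ { refl → refl }) (s ≟ s′)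
    srt _   ≡? var _     = no λ ()
    srt _   ≡? app _ _   = no λ ()
    srt _   ≡? lam _ _   = no λ ()
    var _   ≡? srt _     = no λ ()
    var i   ≡? var j     = map′ (cong var) (λ { refl → refl }) (i ≟ℕ j)
    var _   ≡? app _ _   = no λ ()
    var _   ≡? lam _ _   = no λ ()
    app _ _ ≡? srt _     = no λ ()
    app _ _ ≡? var _     = no λ ()
    app V M ≡? app V′ M′ = map′ (λ { (refl , refl) → refl }) (λ { refl → refl , refl })
                             ((V ≡? V′) ×-dec (M ≡? M′))
    app _ _ ≡? lam _ _   = no λ ()
    lam _ _ ≡? srt _     = no λ ()
    lam _ _ ≡? var _     = no λ ()
    lam _ _ ≡? app _ _   = no λ ()
    lam A b ≡? lam A′ b′ = map′ (λ { (refl , refl) → refl }) (λ { refl → refl , refl })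
                             ((A ≡? A′) ×-dec (b ≡? b′))
    one M   ≡? one M′    = map′ (cong one) (λ { refl → refl }) (M ≡? M′)
    one _   ≡? (_ ∷ _)   = no λ ()
    (_ ∷ _) ≡? one _     = no λ ()
    (M ∷ A) ≡? (M′ ∷ A′) = map′ (λ { (refl , refl) → refl }) (λ { refl → refl , refl })
                             ((M ≡? M′) ×-dec (A ≡? A′))

    ≃-dec : Γ ⊩ X ∶ a → Δ ⊩ Y ∶ a′ → Dec (X ≃ Y)
    ≃-dec s t with normalisation s | normalisation t
    ... | X′ , p , m | Y′ , q , n with X′ ≡? Y′
    ... | yes refl = yes (_ , p , q)
    ... | no  X≢Y  = no λ e → X≢Y (normal-≃ m n
      (≃-trans (≃-sym (⇛*⇒≃ p)) (≃-trans e (⇛*⇒≃ q))))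

  -- Terms whose spine ends in a sort, and terms that reduce to an abstraction.

  data SortSpine : P tm → Set where
    srt : ∀ {s} → SortSpine (srt s)
    app : SortSpine M → SortSpine (app V M)
    lam : SortSpine b → SortSpine (lam As b)

  spine-sub : SortSpine M → SortSpine (sub σ M)
  spine-sub srt     = srt
  spine-sub (app m) = app (spine-sub m)
  spine-sub (lam m) = lam (spine-sub m)

  spine-ren : SortSpine M → SortSpine (ren ξ M)
  spine-ren srt     = srt
  spine-ren (app m) = app (spine-ren m)
  spine-ren (lam m) = lam (spine-ren m)

  spine-⇛ : M ⇛ N → SortSpine M → SortSpine N
  spine-⇛ srt       srt           = srt
  spine-⇛ (app _ m) (app h)       = app (spine-⇛ m h)
  spine-⇛ (lam _ m) (lam h)       = lam (spine-⇛ m h)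
  spine-⇛ (β _ m)   (app (lam h)) = spine-sub (spine-⇛ m h)

  spine-⇛* : M ⇛* N → SortSpine M → SortSpine N
  spine-⇛* []       h = h
  spine-⇛* (r ◅ rs) h = spine-⇛* rs (spine-⇛ r h)

  IsLam : P tm → Set
  IsLam M = ∃[ As ] ∃[ b ] (M ⇛* lam As b)

  -- Such a term is a sort applied to arguments, but a sort has type `ι` and cannot be applied.
  spine-neutral : Neutral M → SortSpine M → ¬ (Γ ⊩ M ∶ a ⇒ c)
  spine-neutral (app _ m) (app h) (app _ t) = spine-neutral m h t

  spine-isLam : Γ ⊩ M ∶ a ⇒ c → SortSpine M → IsLam M
  spine-isLam t h with normalisation t
  ... | _ , r , neutral n = ⊥-elim (spine-neutral n (spine-⇛* r h) (⊩-⇛* r t))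
  ... | _ , r , lam _ _   = _ , _ , r

  isLam-≃ : M ≃ N → IsLam N → IsLam M
  isLam-≃ e (_ , _ , r) with ≃-trans e (⇛*⇒≃ r)
  ... | _ , p , q with lam-⇛*-inv q
  ... | _ , _ , refl , _ = _ , _ , p

  isLam-dec : Γ ⊩ M ∶ a → Dec (IsLam M)
  isLam-dec t with normalisation t
  ... | _ , r , lam _ _   = yes (_ , _ , r)
  ... | _ , r , neutral n = no λ (_ , _ , s) → neutral-not-lam n (confluence r s)
    where
    neutral-not-lam : Neutral N → ¬ (N ≃ lam As b)
    neutral-not-lam n (_ , p , q) with lam-⇛*-inv q
    ... | _ , _ , refl , _ with normal-⇛* (neutral n) p
    neutral-not-lam () _ | _ , _ , refl , _ | refl

  -- Renaming of terms of the calculus, and readback of plain terms.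

  renT : (ℕ → ℕ) → Term S → Term S
  renT ξ (sort s)     = sort s
  renT ξ (var i)      = var (ξ i)
  renT ξ (app V T)    = app (renT ξ V) (renT ξ T)
  renT ξ (bind b V T) = bind b (renT ξ V) (renT (extᵣ ξ) T)
  renT ξ (cast U T)   = cast (renT ξ U) (renT ξ T)

  renT-cong : ξ ≗ ξ′ → ∀ T → renT ξ T ≡ renT ξ′ T
  renT-cong e (sort s)     = refl
  renT-cong e (var i)      = cong var (e i)
  renT-cong e (app V T)    = cong₂ app (renT-cong e V) (renT-cong e T)
  renT-cong e (bind b V T) = cong₂ (bind b) (renT-cong e V)
    (renT-cong (λ { zero → refl ; (suc i) → cong suc (e i) }) T)
  renT-cong e (cast U T)   = cong₂ cast (renT-cong e U) (renT-cong e T)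

  renT-renT : ∀ T → renT ξ′ (renT ξ T) ≡ renT (ξ′ ∘ ξ) T
  renT-renT (sort s)     = refl
  renT-renT (var i)      = refl
  renT-renT (app V T)    = cong₂ app (renT-renT V) (renT-renT T)
  renT-renT (bind b V T) = cong₂ (bind b) (renT-renT V)
    (trans (renT-renT T) (renT-cong (λ { zero → refl ; (suc i) → refl }) T))
  renT-renT (cast U T)   = cong₂ cast (renT-renT U) (renT-renT T)

  renT-id : ∀ T → renT (λ i → i) T ≡ T
  renT-id (sort s)     = refl
  renT-id (var i)      = refl
  renT-id (app V T)    = cong₂ app (renT-id V) (renT-id T)
  renT-id (bind b V T) = cong₂ (bind b) (renT-id V)
    (trans (renT-cong (λ { zero → refl ; (suc i) → refl }) T) (renT-id T))
  renT-id (cast U T)   = cong₂ cast (renT-id U) (renT-id T)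

  lift-renT : ∀ c T → lift c T ≡ renT (λ i → if i <ᵇ c then i else suc i) T
  lift-renT c (sort s)     = refl
  lift-renT c (var i) with i <ᵇ c
  ... | true  = refl
  ... | false = refl
  lift-renT c (app V T)    = cong₂ app (lift-renT c V) (lift-renT c T)
  lift-renT c (bind b V T) = cong₂ (bind b) (lift-renT c V)
    (trans (lift-renT (suc c) T) (renT-cong skip T))
    where
    skip : (λ i → if i <ᵇ suc c then i else suc i) ≗ extᵣ (λ i → if i <ᵇ c then i else suc i)
    skip zero = refl
    skip (suc i) with i <ᵇ c
    ... | true  = refl
    ... | false = refl
  lift-renT c (cast U T)   = cong₂ cast (lift-renT c U) (lift-renT c T)

  ↑-renT : ∀ T → ↑ T ≡ renT suc T
  ↑-renT = lift-renT 0

  ↑-ext : ∀ T → renT (extᵣ ξ) (↑ T) ≡ ↑ (renT ξ T)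
  ↑-ext {ξ = ξ} T = trans (cong (renT (extᵣ ξ)) (↑-renT T))
    (trans (renT-renT T) (sym (trans (↑-renT (renT ξ T)) (renT-renT T))))

  -- Only the first entry of an annotation is an annotation in the calculus; the later entries can
  -- be recomputed as its iterated types.
  readback : (ℕ → ℕ) → P κ → Term S
  readback π (srt s)   = sort s
  readback π (var i)   = var (π i)
  readback π (app V M) = app (readback π V) (readback π M)
  readback π (lam A b) = bind lam (readback π A) (readback (extᵣ π) b)
  readback π (one M)   = readback π M
  readback π (M ∷ A)   = readback π M

  readback-cong : ξ ≗ ξ′ → (X : P κ) → readback ξ X ≡ readback ξ′ X
  readback-cong e (srt s)   = refl
  readback-cong e (var i)   = cong var (e i)
  readback-cong e (app V M) = cong₂ app (readback-cong e V) (readback-cong e M)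
  readback-cong e (lam A b) = cong₂ (bind lam) (readback-cong e A)
    (readback-cong (λ { zero → refl ; (suc i) → cong suc (e i) }) b)
  readback-cong e (one M)   = readback-cong e M
  readback-cong e (M ∷ A)   = readback-cong e M

  readback-ren : (X : P κ) → readback ξ′ (ren ξ X) ≡ readback (ξ′ ∘ ξ) X
  readback-ren (srt s)   = refl
  readback-ren (var i)   = refl
  readback-ren (app V M) = cong₂ app (readback-ren V) (readback-ren M)
  readback-ren (lam A b) = cong₂ (bind lam) (readback-ren A)
    (trans (readback-ren b) (readback-cong (λ { zero → refl ; (suc i) → refl }) b))
  readback-ren (one M)   = readback-ren M
  readback-ren (M ∷ A)   = readback-ren M

  renT-readback : (X : P κ) → renT ξ′ (readback ξ X) ≡ readback (ξ′ ∘ ξ) X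
  renT-readback (srt s)   = refl
  renT-readback (var i)   = refl
  renT-readback (app V M) = cong₂ app (renT-readback V) (renT-readback M)
  renT-readback (lam A b) = cong₂ (bind lam) (renT-readback A)
    (trans (renT-readback b) (readback-cong (λ { zero → refl ; (suc i) → refl }) b))
  renT-readback (one M)   = renT-readback M
  renT-readback (M ∷ A)   = renT-readback M

  ↑-readback : (X : P κ) → ↑ (readback ξ X) ≡ readback (suc ∘ ξ) X
  ↑-readback X = trans (↑-renT _) (renT-readback X)

-- Interpretation of terms at all levels.

module Semantics {S : Set} (next : S → S) (s₀ : S) where

  open Calculus next

  private
    P : Kind → Set
    P = Plain S

  nextⁿ : ℕ → S → S
  nextⁿ zero    s = s
  nextⁿ (suc n) s = nextⁿ n (next s)

  Levels Assignment : Set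
  Levels     = ℕ → P tm
  Assignment = ℕ → Levels

  -- A definition introduces no plain variable, so plain indices count abstractions only and nothing
  -- is shifted under `dfn`.
  extend : Bind → Levels → Assignment → Assignment
  extend lam v ρ = (var 0 ▹ (ren suc ∘ v)) ▹ (λ i k → ren suc (ρ i k))
  extend dfn v ρ = v ▹ ρ

  abstr : Bind → P ls → P tm → P tm
  abstr lam A b = lam A b
  abstr dfn A b = b

  -- Annotations store the levels 0 to `N`. The argument of an application stays at level 0, because
  -- type steps act on the function alone.
  ⟦_⟧ : Term S → ℕ → Assignment → Levels
  ⟦ sort s ⟧     N ρ k       = srt (nextⁿ k s)
  ⟦ var i ⟧      N ρ k       = ρ i k
  ⟦ app V T ⟧    N ρ k       = app (⟦ V ⟧ N ρ 0) (⟦ T ⟧ N ρ k)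
  ⟦ bind b V T ⟧ N ρ k       = abstr b (lst N (⟦ V ⟧ N ρ)) (⟦ T ⟧ N (extend b (⟦ V ⟧ N ρ) ρ) k)
  ⟦ cast U T ⟧   N ρ zero    = ⟦ T ⟧ N ρ zero
  ⟦ cast U T ⟧   N ρ (suc k) = ⟦ U ⟧ N ρ k

  -- In the empty environment variables get a sort, so that EventuallySortSpine holds for any term.
  ⟪_⟫ : Env S → ℕ → Assignment
  ⟪ ∅ ⟫           N i k = srt s₀
  ⟪ K , b ⟨ V ⟩ ⟫ N     = extend b (⟦ V ⟧ N (⟪ K ⟫ N)) (⟪ K ⟫ N)

  -- One notion for four uses: `ξ′` gives weakening, `ξ` strengthening, `σ` substitution, and `≃`
  -- replacement of an assignment by a convertible one.
  record Morphism (ξ ξ′ : ℕ → ℕ) (σ : ℕ → P tm) (ρ ρ′ : Assignment) : Set where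
    constructor morphism
    field at : ∀ i k → sub σ (ρ (ξ i) k) ≃ ρ′ (ξ′ i) k

  open Morphism

  extsᵇ : Bind → (ℕ → P tm) → ℕ → P tm
  extsᵇ lam = exts
  extsᵇ dfn σ = σ

  extend-morphism : ∀ b {ρ ρ′ v v′} → Morphism ξ ξ′ σ ρ ρ′ → (∀ k → sub σ (v k) ≃ v′ k) →
                    Morphism (extᵣ ξ) (extᵣ ξ′) (extsᵇ b σ) (extend b v ρ) (extend b v′ ρ′)
  extend-morphism lam {ρ} {v = v} m e = morphism λ where
    zero    zero    → ≃-refl
    zero    (suc k) → ≃-trans (≡⇒≃ (sub-exts-↑ (v k))) (ren-≃ (e k))
    (suc i) k       → ≃-trans (≡⇒≃ (sub-exts-↑ (ρ _ k))) (ren-≃ (at m i k))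
  extend-morphism dfn m e = morphism λ where
    zero    k → e k
    (suc i) k → at m i k

  ⟦⟧-morphism : ∀ T {N ρ ρ′} → Morphism ξ ξ′ σ ρ ρ′ →
                ∀ k → sub σ (⟦ renT ξ T ⟧ N ρ k) ≃ ⟦ renT ξ′ T ⟧ N ρ′ k
  ⟦⟧-morphism (sort s)   m k = ≃-refl
  ⟦⟧-morphism (var i)    m k = at m i k
  ⟦⟧-morphism (app V T)  m k = app-≃ (⟦⟧-morphism V m 0) (⟦⟧-morphism T m k)
  ⟦⟧-morphism (bind lam V T) {N} m k =
    lam-≃ (sub-lst-≃ N (⟦⟧-morphism V m))
          (⟦⟧-morphism T (extend-morphism lam m (⟦⟧-morphism V m)) k)
  ⟦⟧-morphism (bind dfn V T) m k =
    ⟦⟧-morphism T (extend-morphism dfn m (⟦⟧-morphism V m)) k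
  ⟦⟧-morphism (cast U T) m zero    = ⟦⟧-morphism T m zero
  ⟦⟧-morphism (cast U T) m (suc k) = ⟦⟧-morphism U m k

  -- Semantic validity and its transport along morphisms.

  Family : Set
  Family = ℕ → Assignment

  extendᶠ : Bind → Term S → Family → Family
  extendᶠ b V ρ N = extend b (⟦ V ⟧ N (ρ N)) (ρ N)

  -- Asking for all m ≥ n, and not only for one level, makes the condition stable under type steps.
  Applicable : Family → Term S → Term S → Set
  Applicable ρ V T =
    ∃[ n ] (∀ N m → n ≤ m → ∃[ u ] (⟦ T ⟧ N (ρ N) m ≃ lam (lst N (⟦ V ⟧ N (ρ N) ∘ suc)) u))

  -- Validity with convertibility of interpretations, at all levels and truncations, in place
  -- of the reduction premises; G collects the validity of the declarations of the environment.
  SemValid : Family → (ℕ → Set) → Term S → Set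
  SemValid ρ G (sort s)     = ⊤
  SemValid ρ G (var i)      = G i
  SemValid ρ G (app V T)    = SemValid ρ G V × SemValid ρ G T × Applicable ρ V T
  SemValid ρ G (bind b V T) =
    SemValid ρ G V × SemValid (extendᶠ b V ρ) (SemValid ρ G V ▹ G) T
  SemValid ρ G (cast U T)   =
    SemValid ρ G U × SemValid ρ G T × (∀ N k → ⟦ T ⟧ N (ρ N) (suc k) ≃ ⟦ U ⟧ N (ρ N) k)

  declarations : Env S → ℕ → Set
  declarations ∅           i = ⊥
  declarations (K , b ⟨ V ⟩) = SemValid ⟪ K ⟫ (declarations K) V ▹ declarations K

  _⊨_ : Env S → Term S → Set
  L ⊨ T = SemValid ⟪ L ⟫ (declarations L) T

  semValid-morphism : ∀ T {σ : ℕ → ℕ → P tm} {ρ ρ′ G G′} →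
    (∀ N → Morphism ξ ξ′ (σ N) (ρ N) (ρ′ N)) → (∀ i → G (ξ i) → G′ (ξ′ i)) →
    SemValid ρ G (renT ξ T) → SemValid ρ′ G′ (renT ξ′ T)
  semValid-morphism (sort s) m g t = tt
  semValid-morphism (var i)  m g t = g i t
  semValid-morphism {ξ = ξ} {ξ′ = ξ′} (app V T) {σ} {ρ} {ρ′} m g (v , t , n , f) =
    semValid-morphism V m g v , semValid-morphism T m g t , n , λ N l n≤l →
    let u , e = f N l n≤l in
    _ , ≃-trans (≃-sym (⟦⟧-morphism T (m N) l))
          (≃-trans (sub-≃ e)
            (lam-≃ (sub-lst-≃ N λ k → ⟦⟧-morphism V (m N) (suc k)) ≃-refl))
  semValid-morphism (bind b V T) m g (v , t) =
    semValid-morphism V m g v ,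
    semValid-morphism T (λ N → extend-morphism b (m N) (⟦⟧-morphism V (m N)))
      (λ { zero → semValid-morphism V m g ; (suc i) → g i }) t
  semValid-morphism (cast U T) m g (u , t , e) =
    semValid-morphism U m g u , semValid-morphism T m g t , λ N k →
    ≃-trans (≃-sym (⟦⟧-morphism T (m N) (suc k)))
      (≃-trans (sub-≃ (e N k)) (⟦⟧-morphism U (m N) k))

  id-morphism : ∀ {ρ ρ′ : Assignment} → (∀ i k → ρ i k ≃ ρ′ i k) →
                Morphism (λ i → i) (λ i → i) var ρ ρ′
  id-morphism {ρ} e = morphism λ i k → ≃-trans (≡⇒≃ (sub-var (ρ i k))) (e i k)

  ⟦⟧-sub : ∀ T {N ρ ρ′} → Morphism (λ i → i) (λ i → i) σ ρ ρ′ →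
           ∀ k → sub σ (⟦ T ⟧ N ρ k) ≃ ⟦ T ⟧ N ρ′ k
  ⟦⟧-sub {σ = σ} T {N} {ρ} {ρ′} m k =
    subst (λ T → sub σ (⟦ T ⟧ N ρ k) ≃ ⟦ T ⟧ N ρ′ k) (renT-id T) (⟦⟧-morphism T m k)

  ⟦⟧-≃ : ∀ T {N ρ ρ′} → (∀ i k → ρ i k ≃ ρ′ i k) → ∀ k → ⟦ T ⟧ N ρ k ≃ ⟦ T ⟧ N ρ′ k
  ⟦⟧-≃ T e k = ≃-trans (≡⇒≃ (sym (sub-var _))) (⟦⟧-sub T (id-morphism e) k)

  semValid-sub : ∀ T {σ : ℕ → ℕ → P tm} {ρ ρ′ G G′} →
    (∀ N → Morphism (λ i → i) (λ i → i) (σ N) (ρ N) (ρ′ N)) → (∀ i → G i → G′ i) →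
    SemValid ρ G T → SemValid ρ′ G′ T
  semValid-sub T {ρ = ρ} {ρ′} {G} {G′} m g =
    subst (λ T → SemValid ρ G T → SemValid ρ′ G′ T) (renT-id T) (semValid-morphism T m g)

  weaken : Bind → P tm → P tm
  weaken lam = ren suc
  weaken dfn X = X

  weaken-≃ : ∀ b → M ≃ N → weaken b M ≃ weaken b N
  weaken-≃ lam = ren-≃
  weaken-≃ dfn e = e

  weakening : Bind → ℕ → P tm
  weakening lam i = var (suc i)
  weakening dfn i = var i

  sub-weakening : ∀ b (M : P tm) → sub (weakening b) M ≡ weaken b M
  sub-weakening lam = ren-is-sub
  sub-weakening dfn = sub-var

  extend-weaken : ∀ b {v ρ} i k → weaken b (ρ i k) ≡ extend b v ρ (suc i) k
  extend-weaken lam i k = refl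
  extend-weaken dfn i k = refl

  weakening-morphism : ∀ b {v ρ} → Morphism (λ i → i) suc (weakening b) ρ (extend b v ρ)
  weakening-morphism b = morphism λ i k → ≡⇒≃ (trans (sub-weakening b _) (extend-weaken b i k))

  ⟦⟧-↑ : ∀ b T {N v ρ} k → weaken b (⟦ T ⟧ N ρ k) ≃ ⟦ ↑ T ⟧ N (extend b v ρ) k
  ⟦⟧-↑ b T {N} {v} {ρ} k =
    subst₂ (λ T′ T″ → weaken b (⟦ T′ ⟧ N ρ k) ≃ ⟦ T″ ⟧ N (extend b v ρ) k)
      (renT-id T) (sym (↑-renT T))
      (≃-trans (≡⇒≃ (sym (sub-weakening b _))) (⟦⟧-morphism T (weakening-morphism b) k))

  semValid-↑ : ∀ b T {v : ℕ → Levels} {ρ G C} → SemValid ρ G T →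
               SemValid (λ N → extend b (v N) (ρ N)) (C ▹ G) (↑ T)
  semValid-↑ b T {v} {ρ} {G} {C} =
    subst₂ (λ T′ T″ → SemValid ρ G T′ → SemValid (λ N → extend b (v N) (ρ N)) (C ▹ G) T″)
      (renT-id T) (sym (↑-renT T))
      (semValid-morphism T (λ N → weakening-morphism b) (λ i g → g))

  -- Strengthening, for the reduct of `ζ`: the shift is the source renaming of the morphism, so the
  -- value of the removed variable is never compared.
  semValid-↑⁻¹ : ∀ T {v : ℕ → Levels} {ρ G C} →
                 SemValid (λ N → v N ▹ ρ N) (C ▹ G) (↑ T) → SemValid ρ G T
  semValid-↑⁻¹ T {v} {ρ} {G} {C} =
    subst₂ (λ T′ T″ → SemValid (λ N → v N ▹ ρ N) (C ▹ G) T′ → SemValid ρ G T″)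
      (sym (↑-renT T)) (renT-id T)
      (semValid-morphism T (λ N → morphism λ i k → ≡⇒≃ (sub-var _)) (λ i g → g))

  -- Truncated interpretations and soundness of reduction.

  truncate-⟦⟧ : ∀ T {n m} {ρ ρ′ : Assignment} → n ≤ m → (∀ i k → truncate n tt (ρ i k) ≡ ρ′ i k) →
                ∀ k → truncate n tt (⟦ T ⟧ m ρ k) ≡ ⟦ T ⟧ n ρ′ k
  truncate-extend : ∀ b V {n m} {ρ ρ′ : Assignment} → n ≤ m → (∀ i k → truncate n tt (ρ i k) ≡ ρ′ i k) →
                    ∀ i k → truncate n tt (extend b (⟦ V ⟧ m ρ) ρ i k) ≡ extend b (⟦ V ⟧ n ρ′) ρ′ i k
  truncate-⟦⟧ (sort s)  l e k = refl
  truncate-⟦⟧ (var i)   l e k = e i k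
  truncate-⟦⟧ (app V T) l e k = cong₂ app (truncate-⟦⟧ V l e 0) (truncate-⟦⟧ T l e k)
  truncate-⟦⟧ (bind lam V T) {n} l e k =
    cong₂ lam (truncate-lst n l (truncate-⟦⟧ V l e)) (truncate-⟦⟧ T l (truncate-extend lam V l e) k)
  truncate-⟦⟧ (bind dfn V T) l e k = truncate-⟦⟧ T l (truncate-extend dfn V l e) k
  truncate-⟦⟧ (cast U T) l e zero    = truncate-⟦⟧ T l e zero
  truncate-⟦⟧ (cast U T) l e (suc k) = truncate-⟦⟧ U l e k
  truncate-extend lam V l e zero zero    = refl
  truncate-extend lam V {n} l e zero (suc k) =
    trans (truncate-ren n tt _) (cong (ren suc) (truncate-⟦⟧ V l e k))
  truncate-extend lam V {n} l e (suc i) k    = trans (truncate-ren n tt _) (cong (ren suc) (e i k))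
  truncate-extend dfn V l e zero k       = truncate-⟦⟧ V l e k
  truncate-extend dfn V l e (suc i) k    = e i k

  -- Together with `truncate-⟦⟧`, this brings conversions obtained at a large truncation down to any
  -- smaller one.
  truncate-⟪⟫ : ∀ L {n m} → n ≤ m → ∀ i k → truncate n tt (⟪ L ⟫ m i k) ≡ ⟪ L ⟫ n i k
  truncate-⟪⟫ ∅             l i k = refl
  truncate-⟪⟫ (K , b ⟨ V ⟩) l     = truncate-extend b V l (truncate-⟪⟫ K l)

  -- The levels of W cut off at truncation N are compared at a larger truncation first.
  argument-type : ∀ L {V W B} → Applicable ⟪ L ⟫ V (bind lam W B) →
                  ∀ N k → ⟦ V ⟧ N (⟪ L ⟫ N) (suc k) ≃ ⟦ W ⟧ N (⟪ L ⟫ N) k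
  argument-type L {V} {W} (n , f) N k =
    subst₂ _≃_ (truncate-⟦⟧ V N≤ (truncate-⟪⟫ L N≤) (suc k)) (truncate-⟦⟧ W N≤ (truncate-⟪⟫ L N≤) k)
      (truncate-≃ N (≃-sym (lst-injective (N ⊔ k)
        (lam-injectiveˡ (proj₂ (f (N ⊔ k) n ≤-refl))) (m≤n⊔m N k))))
    where
    N≤ : N ≤ N ⊔ k
    N≤ = m≤m⊔n N k

  -- Induction on the step. The conversions for the parts that reduce are what re-establishes the
  -- cast and application conditions of the reduct, so both conclusions are proved together.
  sound : ∀ {L T T′ n} → L ⊢ T ⟶[ n ] T′ → L ⊨ T →
          (∀ N k → ⟦ T ⟧ N (⟪ L ⟫ N) (n + k) ≃ ⟦ T′ ⟧ N (⟪ L ⟫ N) k) × L ⊨ T′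
  sound {L} (β {V = V} {W} {B}) (v , (w , t) , f) =
    (λ N k → ≃-trans β-≃ (⟦⟧-sub B (contract N) k)) ,
    (w , v , types) ,
    semValid-sub B contract (λ { zero w → w , v , types ; (suc i) g → g }) t
    where
    types : ∀ N k → ⟦ V ⟧ N (⟪ L ⟫ N) (suc k) ≃ ⟦ W ⟧ N (⟪ L ⟫ N) k
    types = argument-type L {V} {W} {B} f
    -- Once its level 0 is replaced by `V`, the bound variable has `V` at level 0 and level `k` of
    -- `W` at level `k + 1`: by definition the levels of `cast W V`.
    contract : ∀ N → Morphism (λ i → i) (λ i → i) (⟦ V ⟧ N (⟪ L ⟫ N) 0 ▹ var)
      (extend lam (⟦ W ⟧ N (⟪ L ⟫ N)) (⟪ L ⟫ N)) (extend dfn (⟦ cast W V ⟧ N (⟪ L ⟫ N)) (⟪ L ⟫ N))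
    contract N = morphism λ where
      zero    zero    → ≃-refl
      zero    (suc k) → ≡⇒≃ (sub-▹-↑-var _)
      (suc i) k       → ≡⇒≃ (sub-▹-↑-var _)
  sound (δ {V = V}) t = (λ N k → ⟦⟧-↑ dfn V k) , semValid-↑ dfn V t
  sound (ζ {T = T}) (v , t) = (λ N k → ≃-sym (⟦⟧-↑ dfn T k)) , semValid-↑⁻¹ T t
  sound (θ {V = V} {W} {T}) (v , (w , t) , n , f) =
    (λ N k → app-≃ (⟦⟧-↑ dfn V 0) ≃-refl) ,
    w , semValid-↑ dfn V v , t , n , λ N m l →
      _ , ≃-trans (proj₂ (f N m l)) (lam-≃ (lst-≃ N λ k → ⟦⟧-↑ dfn V (suc k)) ≃-refl)
  sound ε (u , t , e) = (λ { N zero → ≃-refl ; N (suc k) → ≃-sym (e N k) }) , t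
  sound srt t = (λ N k → ≃-refl) , tt
  sound (ℓ {W = W}) t = (λ N k → ⟦⟧-↑ lam W k) , semValid-↑ lam W t
  sound ee (u , t , e) = (λ N k → ≃-refl) , u
  sound (lref {n = n} {T = T} {b = b} r) t with sound r t
  ... | e , t′ =
    (λ N k → ≃-trans (≡⇒≃ (sym (extend-weaken b _ (n + k))))
               (≃-trans (weaken-≃ b (e N k)) (⟦⟧-↑ b T k))) ,
    semValid-↑ b T t′
  sound (appV r) (v , t , n , f) with sound r v
  ... | e , v′ =
    (λ N k → app-≃ (e N 0) ≃-refl) ,
    v′ , t , n , λ N m l →
      _ , ≃-trans (proj₂ (f N m l)) (lam-≃ (lst-≃ N λ k → e N (suc k)) ≃-refl)
  sound (appT {n = i} r) (v , t , n , f) with sound r t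
  ... | e , t′ =
    (λ N k → app-≃ ≃-refl (e N k)) ,
    v , t′ , n , λ N m l →
      -- Level `m` of the reduct is level `i + m` of the original function, which is still at least
      -- `n`.
      _ , ≃-trans (≃-sym (e N m)) (proj₂ (f N (i + m) (≤-trans l (m≤n+m m i))))
  sound {L} (bndV {b = b} {V₁} {V₂} {T} r) (v , t) with sound r v
  ... | e , v′ = conv b , v′ , semValid-sub T (λ N → id-morphism (change b N))
                   (λ { zero _ → v′ ; (suc i) g → g }) t
    where
    change : ∀ b N i k → extendᶠ b V₁ ⟪ L ⟫ N i k ≃ extendᶠ b V₂ ⟪ L ⟫ N i k
    change lam N zero    zero    = ≃-refl
    change lam N zero    (suc k) = ren-≃ (e N k)
    change lam N (suc i) k       = ≃-refl
    change dfn N zero    k       = e N k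
    change dfn N (suc i) k       = ≃-refl
    conv : ∀ b N k → ⟦ bind b V₁ T ⟧ N (⟪ L ⟫ N) k ≃ ⟦ bind b V₂ T ⟧ N (⟪ L ⟫ N) k
    conv lam N k = lam-≃ (lst-≃ N (e N)) (⟦⟧-≃ T (change lam N) k)
    conv dfn N k = ⟦⟧-≃ T (change dfn N) k
  sound {L} (bndT {b = b} {V} {T₁} {T₂} {n} r) (v , t) with sound r t
  ... | e , t′ = conv b e , v , t′
    where
    conv : ∀ b → (∀ N k → ⟦ T₁ ⟧ N (⟪ L , b ⟨ V ⟩ ⟫ N) (n + k) ≃ ⟦ T₂ ⟧ N (⟪ L , b ⟨ V ⟩ ⟫ N) k) →
           ∀ N k → ⟦ bind b V T₁ ⟧ N (⟪ L ⟫ N) (n + k) ≃ ⟦ bind b V T₂ ⟧ N (⟪ L ⟫ N) k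
    conv lam e N k = lam-≃ ≃-refl (e N k)
    conv dfn e     = e
  sound (cstU r) (u , t , c) with sound r u
  ... | e , u′ = (λ { N zero → ≃-refl ; N (suc k) → e N k }) ,
                 u′ , t , λ N k → ≃-trans (c N k) (e N k)
  sound (cstT r) (u , t , c) with sound r t
  ... | e , t′ = (λ { N zero → e N zero ; N (suc k) → ≃-refl }) ,
                 u , t′ , λ N k → ≃-trans (≃-sym (e N (suc k))) (c N k)
  sound (cst1 r s) (u , t , c) with sound r u | sound s t
  ... | e , u′ | e′ , t′ =
    -- Level 1 of the original cast is `U₁` at level 0, while level 0 of the reduct is `T₂` at level
    -- 0; the cast condition links them through `T₁` at level 1.
    (λ { N zero → ≃-trans (≃-sym (c N zero)) (e′ N zero) ; N (suc k) → e N k }) ,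
    u′ , t′ , λ N k → ≃-trans (≃-sym (e′ N (suc k))) (≃-trans (c N (suc k)) (e N k))

  sound* : ∀ {L T T′ n} → L ⊢ T ⟶*[ n ] T′ → L ⊨ T →
           (∀ N k → ⟦ T ⟧ N (⟪ L ⟫ N) (n + k) ≃ ⟦ T′ ⟧ N (⟪ L ⟫ N) k) × L ⊨ T′
  sound* refl*     t = (λ N k → ≃-refl) , t
  sound* (step* r) t = sound r t
  sound* {L} {T} (trans* {n₁ = n₁} {n₂} r s) t with sound* r t
  ... | e , t′ with sound* s t′
  ... | e′ , t″ =
    (λ N k → ≃-trans (≡⇒≃ (cong (⟦ T ⟧ N (⟪ L ⟫ N)) (+-assoc n₁ n₂ k)))
               (≃-trans (e N (n₂ + k)) (e′ N k))) , t″

  valid⇒semValid : ∀ {L A T} → L ⊢[ A ] T → L ⊨ T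
  valid⇒semValid v-sort       = tt
  valid⇒semValid (v-var0 v)   = valid⇒semValid v
  valid⇒semValid (v-varS v)   = valid⇒semValid v
  valid⇒semValid (v-bind v t) = valid⇒semValid v , valid⇒semValid t
  valid⇒semValid (v-cast u t r s) =
    let u′ = valid⇒semValid u ; t′ = valid⇒semValid t in
    u′ , t′ , λ N k → ≃-trans (proj₁ (sound* r t′) N k) (≃-sym (proj₁ (sound* s u′) N k))
  valid⇒semValid {L} (v-app {V = V} {T} {n} v t _ r s) =
    let v′ = valid⇒semValid v ; t′ = valid⇒semValid t in
    v′ , t′ , n , applicable v′ t′
    where
    applicable : L ⊨ V → L ⊨ T → ∀ N m → n ≤ m →
      ∃[ u ] (⟦ T ⟧ N (⟪ L ⟫ N) m ≃ lam (lst N (⟦ V ⟧ N (⟪ L ⟫ N) ∘ suc)) u)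
    applicable v′ t′ N m l with m≤n⇒∃[o]m+o≡n l
    ... | o , refl = _ , ≃-trans (proj₁ (sound* r t′) N o)
      (lam-≃ (lst-≃ N λ k → ≃-sym (proj₁ (sound* s v′) N k)) ≃-refl)

  -- Arities and simple typing of interpretations.

  dom cod : Ty → Ty
  dom ι       = ι
  dom (a ⇒ c) = a
  cod ι       = ι
  cod (a ⇒ c) = c

  arity : (ℕ → Ty) → Term S → Ty
  arity γ (sort s)       = ι
  arity γ (var i)        = γ i
  arity γ (app V T)      = cod (arity γ T)
  arity γ (bind lam V T) = arity γ V ⇒ arity (arity γ V ▹ γ) T
  arity γ (bind dfn V T) = arity (arity γ V ▹ γ) T
  arity γ (cast U T)     = arity γ U

  arities : Env S → ℕ → Ty
  arities ∅             i = ι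
  arities (K , b ⟨ V ⟩)   = arity (arities K) V ▹ arities K

  context : Env S → ℕ → Ty
  context ∅               i = ι
  context (K , lam ⟨ V ⟩)   = arity (arities K) V ▹ context K
  context (K , dfn ⟨ V ⟩)   = context K

  -- Truncation 0 suffices for typing and deciding: the premises to be tested compare level 1 of a
  -- term with an expected type or annotation at level 0.
  ⟦_⟧₀ : Term S → Env S → Levels
  ⟦ T ⟧₀ L = ⟦ T ⟧ 0 (⟪ L ⟫ 0)

  -- One arity serves all levels. At level 0 of a cast, `T` has the arity of `U` since level 1 of
  -- `T` converts to level 0 of `U` and conversion preserves types.
  ⟦⟧₀-typed : ∀ {L A T} → L ⊢[ A ] T → ∀ k → context L ⊩ ⟦ T ⟧₀ L k ∶ arity (arities L) T
  ⟦⟧₀-typed v-sort k = srt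
  ⟦⟧₀-typed (v-var0 {b = lam} v) zero    = var refl
  ⟦⟧₀-typed (v-var0 {b = lam} v) (suc k) = ⊩-↑ (⟦⟧₀-typed v k)
  ⟦⟧₀-typed (v-var0 {b = dfn} v) k       = ⟦⟧₀-typed v k
  ⟦⟧₀-typed (v-varS {b = lam} v) k       = ⊩-↑ (⟦⟧₀-typed v k)
  ⟦⟧₀-typed (v-varS {b = dfn} v) k       = ⟦⟧₀-typed v k
  ⟦⟧₀-typed (v-bind {b = lam} v t) k     = lam (one (⟦⟧₀-typed v 0)) (⟦⟧₀-typed t k)
  ⟦⟧₀-typed (v-bind {b = dfn} v t) k     = ⟦⟧₀-typed t k
  ⟦⟧₀-typed {L} {A} w@(v-cast {T = T} u t _ _) zero =
    subst (context L ⊩ ⟦ T ⟧₀ L 0 ∶_)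
      (≃-same-type (proj₂ (proj₂ (valid⇒semValid w)) 0 0) (⟦⟧₀-typed t 1) (⟦⟧₀-typed u 0))
      (⟦⟧₀-typed t 0)
  ⟦⟧₀-typed (v-cast u t _ _) (suc k) = ⟦⟧₀-typed u k
  ⟦⟧₀-typed {L} w@(v-app {V = V} {T} v t _ _ _) k
    with arity (arities L) T | ⟦⟧₀-typed t | valid⇒semValid w
  -- Level `n` of `T` reduces to an abstraction whose annotation is a reduct of level 1 of `V`. This
  -- forces the arity of `T`, common to all levels, to be an arrow from the arity of `V`.
  ... | a | t′ | _ , _ , n , f with f 0 n ≤-refl
  ... | u , _ , p , q with lam-⇛*-inv q
  ... | _ , _ , refl , r , _ with ⊩-⇛* p (t′ n)
  ... | lam s _ with ⊩-unique s (⊩-⇛* r (one (⟦⟧₀-typed v 1)))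
  ... | refl = app (⟦⟧₀-typed v 0) (t′ k)

  -- Reduction of a term to the readback of its interpretation.

  weaken-⟶ : ∀ {L L′ T T′ n ξ} → (∀ {i n T} → L ⊢ var i ⟶[ n ] T → L′ ⊢ var (ξ i) ⟶[ n ] renT ξ T) →
             L ⊢ T ⟶[ n ] T′ → L′ ⊢ renT ξ T ⟶[ n ] renT ξ T′
  -- The hypothesis of `weaken-⟶` concerns variables only, since `δ`, `ℓ` and `lref` are the rules
  -- that look up the environment; here it is carried under a binder.
  weaken-⟶-bind : ∀ {L L′ b V ξ} → (∀ {i n T} → L ⊢ var i ⟶[ n ] T → L′ ⊢ var (ξ i) ⟶[ n ] renT ξ T) →
    ∀ {i n T} → (L , b ⟨ V ⟩) ⊢ var i ⟶[ n ] T →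
    (L′ , b ⟨ renT ξ V ⟩) ⊢ var (extᵣ ξ i) ⟶[ n ] renT (extᵣ ξ) T
  weaken-⟶ e β = β
  weaken-⟶ e r@δ = e r
  weaken-⟶ {L′ = L′} {ξ = ξ} e (ζ {V = V} {T}) =
    subst (λ T′ → L′ ⊢ bind dfn (renT ξ V) T′ ⟶[ 0 ] renT ξ T) (sym (↑-ext T)) ζ
  weaken-⟶ {L′ = L′} {ξ = ξ} e (θ {V = V} {W} {T}) =
    subst (λ V′ → L′ ⊢ app (renT ξ V) (bind dfn (renT ξ W) (renT (extᵣ ξ) T)) ⟶[ 0 ]
                  bind dfn (renT ξ W) (app V′ (renT (extᵣ ξ) T))) (sym (↑-ext V)) θ
  weaken-⟶ e ε = ε
  weaken-⟶ e srt = srt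
  weaken-⟶ e r@ℓ = e r
  weaken-⟶ e ee = ee
  weaken-⟶ e r@(lref _) = e r
  weaken-⟶ e (appV r) = appV (weaken-⟶ e r)
  weaken-⟶ e (appT r) = appT (weaken-⟶ e r)
  weaken-⟶ e (bndV r) = bndV (weaken-⟶ e r)
  weaken-⟶ e (bndT r) = bndT (weaken-⟶ (weaken-⟶-bind e) r)
  weaken-⟶ e (cstU r) = cstU (weaken-⟶ e r)
  weaken-⟶ e (cstT r) = cstT (weaken-⟶ e r)
  weaken-⟶ e (cst1 r s) = cst1 (weaken-⟶ e r) (weaken-⟶ e s)
  weaken-⟶-bind {L′ = L′} {ξ = ξ} e (δ {V = V}) =
    subst ((L′ , dfn ⟨ renT ξ V ⟩) ⊢ var 0 ⟶[ 0 ]_) (sym (↑-ext V)) δ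
  weaken-⟶-bind {L′ = L′} {ξ = ξ} e (ℓ {W = W}) =
    subst ((L′ , lam ⟨ renT ξ W ⟩) ⊢ var 0 ⟶[ 1 ]_) (sym (↑-ext W)) ℓ
  weaken-⟶-bind e (lref {n = n} {T = T} r) = subst (_ ⊢ _ ⟶[ n ]_) (sym (↑-ext T)) (lref (e r))

  ↑-⟶* : ∀ {K b V T T′ n} → K ⊢ T ⟶*[ n ] T′ → (K , b ⟨ V ⟩) ⊢ ↑ T ⟶*[ n ] ↑ T′
  ↑-⟶* refl* = refl*
  ↑-⟶* {K} {b} {V} {T} {T′} (step* {n = n} r) =
    step* (subst₂ (λ T T′ → (K , b ⟨ V ⟩) ⊢ T ⟶[ n ] T′) (sym (↑-renT T)) (sym (↑-renT T′))
      (weaken-⟶ (λ {_} {n} {T} r → subst (_ ⊢ _ ⟶[ n ]_) (↑-renT T) (lref r)) r))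
  ↑-⟶* (trans* r s) = trans* (↑-⟶* r) (↑-⟶* s)

  map* : ∀ {L L′ T T′ n} (f : Term S → Term S) →
         (∀ {n T T′} → L ⊢ T ⟶[ n ] T′ → L′ ⊢ f T ⟶[ n ] f T′) →
         L ⊢ T ⟶*[ n ] T′ → L′ ⊢ f T ⟶*[ n ] f T′
  map* f g refl*        = refl*
  map* f g (step* r)    = step* (g r)
  map* f g (trans* r s) = trans* (map* f g r) (map* f g s)

  -- The index is a variable with an equation because `trans*` produces a sum, which does not unify
  -- with 0.
  map*₀ : ∀ {L T T′ n} (f : Term S → Term S) →
          (∀ {T T′} → L ⊢ T ⟶[ 0 ] T′ → L ⊢ f T ⟶[ 0 ] f T′) →
          L ⊢ T ⟶*[ n ] T′ → n ≡ 0 → L ⊢ f T ⟶*[ 0 ] f T′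
  map*₀ f g refl*     _    = refl*
  map*₀ f g (step* r) refl = step* (g r)
  map*₀ f g (trans* {n₁ = n₁} r s) e =
    trans* (map*₀ f g r (m+n≡0⇒m≡0 n₁ e)) (map*₀ f g s (m+n≡0⇒n≡0 n₁ e))

  app* : ∀ {L V V′ T T′ n} → L ⊢ V ⟶*[ 0 ] V′ → L ⊢ T ⟶*[ n ] T′ → L ⊢ app V T ⟶*[ n ] app V′ T′
  app* {V′ = V′} {T} r s = trans* (map*₀ (λ V → app V T) appV r refl) (map* (app V′) appT s)

  bind* : ∀ {L b V V′ T T′ n} → L ⊢ V ⟶*[ 0 ] V′ → (L , b ⟨ V ⟩) ⊢ T ⟶*[ n ] T′ →
          L ⊢ bind b V T ⟶*[ n ] bind b V′ T′
  bind* {L} {b} {V} {V′} {T} {T′} {n} r s =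
    subst (L ⊢ bind b V T ⟶*[_] bind b V′ T′) (+-identityʳ n)
      -- The body goes first, while the environment still contains the original `V`.
      (trans* (map* (bind b V) bndT s) (map*₀ (λ V → bind b V T′) bndV r refl))

  unfold* : ∀ {L V T T′ n} → (L , dfn ⟨ V ⟩) ⊢ T ⟶*[ n ] ↑ T′ → L ⊢ bind dfn V T ⟶*[ n ] T′
  unfold* {L} {V} {T} {T′} {n} r =
    subst (L ⊢ bind dfn V T ⟶*[_] T′) (+-identityʳ n) (trans* (map* (bind dfn V) bndT r) (step* ζ))

  -- Plain terms have no variables for definitions; positions L turns their indices into indices in L.
  positions : Env S → ℕ → ℕ
  positions ∅               = λ i → i
  positions (K , lam ⟨ V ⟩) = extᵣ (positions K)
  positions (K , dfn ⟨ V ⟩) = suc ∘ positions K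

  ↑-readback-extᵣ : ∀ {π} (M : P tm) → ↑ (readback π M) ≡ readback (extᵣ π) (ren suc M)
  ↑-readback-extᵣ M = trans (↑-readback M) (sym (readback-ren M))

  ↑-readback-positions : ∀ K b {V} (M : P tm) →
    ↑ (readback (positions K) M) ≡ readback (positions (K , b ⟨ V ⟩)) (weaken b M)
  ↑-readback-positions K lam = ↑-readback-extᵣ
  ↑-readback-positions K dfn = ↑-readback

  _⟶*≡_ : ∀ {L T T′ T″ n} → L ⊢ T ⟶*[ n ] T′ → T′ ≡ T″ → L ⊢ T ⟶*[ n ] T″
  r ⟶*≡ refl = r

  -- The converse of soundness: `δ` and `ζ` eliminate definitions, `ε` and `ee` casts, and `srt`,
  -- `ℓ` and `ee` supply the type steps. The validity derivation also covers the declarations met on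
  -- looking up a variable.
  reach : ∀ {L A T} → L ⊢[ A ] T → ∀ k → L ⊢ T ⟶*[ k ] readback (positions L) (⟦ T ⟧₀ L k)
  reach (v-sort {s = s}) k = steps k s
    where
    steps : ∀ {L} k s → L ⊢ sort s ⟶*[ k ] sort (nextⁿ k s)
    steps zero    s = refl*
    steps (suc k) s = trans* (step* srt) (steps k (next s))
  reach (v-var0 {b = lam} v) zero = refl*
  reach {L} (v-var0 {K} {b = lam} {V} v) (suc k) =
    trans* (step* ℓ) (↑-⟶* (reach v k) ⟶*≡ ↑-readback-positions K lam {V} (⟦ V ⟧₀ K k))
  reach {L} (v-var0 {K} {b = dfn} {V} v) k =
    trans* (step* δ) (↑-⟶* (reach v k) ⟶*≡ ↑-readback-positions K dfn {V} (⟦ V ⟧₀ K k))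
  reach (v-varS {K} {b = b} {i = i} v) k =
    ↑-⟶* (reach v k) ⟶*≡ trans (↑-readback-positions K b (⟦ var i ⟧₀ K k))
                            (cong (readback _) (extend-weaken b i k))
  reach (v-bind {b = lam} v t) k = bind* (reach v 0) (reach t k)
  reach (v-bind {L} {b = dfn} {V} {T} v t) k =
    unfold* (reach t k ⟶*≡ sym (↑-readback (⟦ T ⟧₀ (L , dfn ⟨ V ⟩) k)))
  reach (v-cast u t _ _) zero    = trans* (step* ε) (reach t 0)
  reach (v-cast u t _ _) (suc k) = trans* (step* ee) (reach u k)
  reach (v-app v t _ _ _) k = app* (reach v 0) (reach t k)

  readback-sub : ∀ {L π π′ σ} (X : P κ) → (∀ i → L ⊢ var (π i) ⟶*[ 0 ] readback π′ (σ i)) →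
                 L ⊢ readback π X ⟶*[ 0 ] readback π′ (sub σ X)
  readback-sub (srt s)   e = refl*
  readback-sub (var i)   e = e i
  readback-sub (app V M) e = app* (readback-sub V e) (readback-sub M e)
  readback-sub {π = π} {π′} {σ} (lam A b) e = bind* (readback-sub A e) (readback-sub b e′)
    where
    e′ : ∀ i → (_ , lam ⟨ _ ⟩) ⊢ var (extᵣ π i) ⟶*[ 0 ] readback (extᵣ π′) (exts σ i)
    e′ zero    = refl*
    e′ (suc i) = ↑-⟶* (e i) ⟶*≡ ↑-readback-extᵣ (σ i)
  readback-sub (one M)   e = readback-sub M e
  readback-sub (M ∷ A)   e = readback-sub M e

  -- A plain β-step is simulated by turning the redex into a definition, unfolding each occurrence
  -- with `δ` and removing its cast with `ε`, and dropping the definition with `ζ`.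
  readback-⇛ : ∀ {L π} {X Y : P κ} → X ⇛ Y → L ⊢ readback π X ⟶*[ 0 ] readback π Y
  readback-⇛ srt       = refl*
  readback-⇛ var       = refl*
  readback-⇛ (app v m) = app* (readback-⇛ v) (readback-⇛ m)
  readback-⇛ (lam a m) = bind* (readback-⇛ a) (readback-⇛ m)
  readback-⇛ (one m)   = readback-⇛ m
  readback-⇛ (m ∷ a)   = readback-⇛ m
  readback-⇛ {L = L} {π} (β {V} {V′} {b} {b′} {As} v m) =
    trans* (step* β) (unfold* (trans* (readback-⇛ m)
      (readback-sub b′ e ⟶*≡ sym (↑-readback (sub (V′ ▹ var) b′)))))
    where
    e : ∀ i → (L , dfn ⟨ cast (readback π As) (readback π V) ⟩) ⊢
        var (extᵣ π i) ⟶*[ 0 ] readback (suc ∘ π) ((V′ ▹ var) i)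
    e zero    = trans* (step* δ)
      (↑-⟶* (trans* (step* (ε {U = readback π As})) (readback-⇛ v)) ⟶*≡ ↑-readback V′)
    e (suc i) = refl*

  readback-⇛* : ∀ {L π} {X Y : P κ} → X ⇛* Y → L ⊢ readback π X ⟶*[ 0 ] readback π Y
  readback-⇛* []       = refl*
  readback-⇛* (r ◅ rs) = trans* (readback-⇛ r) (readback-⇛* rs)

  reach* : ∀ {L A T} → L ⊢[ A ] T → ∀ k {M} → ⟦ T ⟧₀ L k ⇛* M → L ⊢ T ⟶*[ k ] readback (positions L) M
  reach* {L} {T = T} t k {M} r =
    subst (L ⊢ T ⟶*[_] readback (positions L) M) (+-identityʳ k) (trans* (reach t k) (readback-⇛* r))

  -- Behaviour of the interpretation at large levels.

  EventuallySortSpine : Levels → Set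
  EventuallySortSpine v = ∃[ n ] (∀ m → n ≤ m → SortSpine (v m))

  extend-spine : ∀ b {v ρ} → EventuallySortSpine v → (∀ i → EventuallySortSpine (ρ i)) →
                 ∀ i → EventuallySortSpine (extend b v ρ i)
  extend-spine lam (n , h) e zero    = suc n , λ { (suc m) (s≤s l) → spine-ren (h m l) }
  extend-spine lam _       e (suc i) = proj₁ (e i) , λ m l → spine-ren (proj₂ (e i) m l)
  extend-spine dfn h       e zero    = h
  extend-spine dfn h       e (suc i) = e i

  -- Each type step replaces an abstraction variable at the head by its annotation, which lives in a
  -- shorter environment, so the head is a sort after finitely many steps.
  ⟦⟧-spine : ∀ T {N ρ} → (∀ i → EventuallySortSpine (ρ i)) → EventuallySortSpine (⟦ T ⟧ N ρ)
  ⟦⟧-spine (sort s)       e = 0 , λ m l → srt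
  ⟦⟧-spine (var i)        e = e i
  ⟦⟧-spine (app V T)      e = proj₁ (⟦⟧-spine T e) , λ m l → app (proj₂ (⟦⟧-spine T e) m l)
  ⟦⟧-spine (bind lam V T) e =
    let n , h = ⟦⟧-spine T (extend-spine lam (⟦⟧-spine V e) e) in n , λ m l → lam (h m l)
  ⟦⟧-spine (bind dfn V T) e = ⟦⟧-spine T (extend-spine dfn (⟦⟧-spine V e) e)
  ⟦⟧-spine (cast U T)     e =
    let n , h = ⟦⟧-spine U e in suc n , λ { (suc m) (s≤s l) → h m l }

  ⟪⟫-spine : ∀ L {N} i → EventuallySortSpine (⟪ L ⟫ N i)
  ⟪⟫-spine ∅             i = 0 , λ m l → srt
  ⟪⟫-spine (K , b ⟨ V ⟩)   = extend-spine b (⟦⟧-spine V (⟪⟫-spine K)) (⟪⟫-spine K)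

  -- A term that reduces to an abstraction keeps its annotation at all higher levels, by soundness of
  -- the reduction to the readback.
  lam-level : ∀ {L A T n As b} → L ⊢[ A ] T → ⟦ T ⟧₀ L n ⇛* lam As b →
              ∀ k → ∃[ b′ ] (⟦ T ⟧₀ L (n + k) ≃ lam As b′)
  lam-level {L} {T = T} {n} {As} {b} t r k =
    _ , ≃-trans (e k) (lam-≃ (≃-sym As≃) ≃-refl)
    where
    e : ∀ k → ⟦ T ⟧₀ L (n + k) ≃ ⟦ readback (positions L) (lam As b) ⟧₀ L k
    e = proj₁ (sound* (reach* t n r) (valid⇒semValid t)) 0
    As≃ : As ≃ one (⟦ readback (positions L) As ⟧₀ L 0)
    As≃ = lam-injectiveˡ (≃-trans (≃-sym (⇛*⇒≃ r))
            (≃-trans (≡⇒≃ (cong (⟦ T ⟧₀ L) (sym (+-identityʳ n)))) (e 0)))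

  isLam-upward : ∀ {L A T n m} → L ⊢[ A ] T → n ≤ m → IsLam (⟦ T ⟧₀ L n) → IsLam (⟦ T ⟧₀ L m)
  isLam-upward t l (_ , _ , r) with m≤n⇒∃[o]m+o≡n l
  ... | o , refl = isLam-≃ (proj₂ (lam-level t r o)) (_ , _ , [])

  ⟶*-isLam : ∀ {L A T n W U} → L ⊢[ A ] T → L ⊢ T ⟶*[ n ] bind lam W U →
             ∀ k → ∃[ b ] (⟦ T ⟧₀ L (n + k) ≃ lam (one (⟦ W ⟧₀ L 0)) b)
  ⟶*-isLam t r k = _ , proj₁ (sound* r (valid⇒semValid t)) 0 k

  -- A single level that reduces to an abstraction makes the arity an arrow, and all levels share
  -- that arity.
  typed-at-lam : ∀ {L A T n W U} → L ⊢[ A ] T → L ⊢ T ⟶*[ n ] bind lam W U → ∀ k →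
    context L ⊩ ⟦ T ⟧₀ L k ∶ dom (arity (arities L) T) ⇒ cod (arity (arities L) T)
  typed-at-lam {L} {T = T} {n} t r k with ⟶*-isLam t r 0
  ... | _ , _ , p , q with lam-⇛*-inv q
  ... | _ , _ , refl , _ with arity (arities L) T | ⟦⟧₀-typed t
  ... | _ | t′ with ⊩-⇛* p (t′ (n + 0))
  ... | lam _ _ = t′ k

  -- The decision procedure.

  module _ (_≟_ : DecidableEquality S) (A : ℕ → Set)
           (bounded? : (n₁ : ℕ) → Dec (∃[ n₂ ] (A n₂ × n₁ ≤ n₂))) where

    least : {Q : ℕ → Set} → (∀ n → Dec (Q n)) → ∀ n → Q n → ∃[ m ] (Q m × (∀ k → Q k → m ≤ k))
    least Q? zero    q = 0 , q , λ _ _ → z≤n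
    least Q? (suc n) q with Q? 0
    ... | yes q₀ = 0 , q₀ , λ _ _ → z≤n
    ... | no ¬q₀ with least (Q? ∘ suc) n q
    ... | m , qₘ , f = suc m , qₘ , λ { zero q₀ → ⊥-elim (¬q₀ q₀) ; (suc k) qₖ → s≤s (f k qₖ) }

    cast-dec : ∀ {L U T} → L ⊢[ A ] U → L ⊢[ A ] T → Dec (L ⊢[ A ] cast U T)
    cast-dec u t with ≃-dec _≟_ (⟦⟧₀-typed t 1) (⟦⟧₀-typed u 0)
    ... | yes (_ , p , q) = yes (v-cast u t (reach* t 1 p) (reach* u 0 q))
    ... | no ¬e = no λ { w@(v-cast _ _ _ _) → ¬e (proj₂ (proj₂ (valid⇒semValid w)) 0 0) }

    -- A level `n` in `A` at which `T` is an abstraction decides the matter, because the domain is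
    -- the same up to conversion at every level where `T` is an abstraction.
    domain-dec : ∀ {L V T n As b} → L ⊢[ A ] V → L ⊢[ A ] T → A n → ⟦ T ⟧₀ L n ⇛* lam As b →
                 Dec (L ⊢[ A ] app V T)
    domain-dec {L} {V} {T} {n} {As} v t a r
      with ≃-dec _≟_ (proj₂ (⊩-annotation (⊩-⇛* r (⟦⟧₀-typed t n)))) (one (⟦⟧₀-typed v 1))
    ... | no ¬e = no λ { (v-app {n = m} _ _ _ r′ s) → ¬e (domains m r′ s) }
      where
      domains : ∀ m {W U} → L ⊢ T ⟶*[ m ] bind lam W U → L ⊢ V ⟶*[ 1 ] W → As ≃ one (⟦ V ⟧₀ L 1)
      -- A derivation may use another level `m`; both domains persist up to the common level
      -- `n + m`, where they are compared.
      domains m r′ s = ≃-trans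
        (lam-injectiveˡ (≃-trans (≃-sym (proj₂ (lam-level t r m)))
          (≃-trans (≡⇒≃ (cong (⟦ T ⟧₀ L) (+-comm n m))) (proj₂ (⟶*-isLam t r′ n)))))
        (one-≃ (≃-sym (proj₁ (sound* s (valid⇒semValid v)) 0 0)))
    ... | yes (_ , p , q) with one-⇛*-inv q
    ... | _ , refl , q′ = yes (v-app v t a (reach* t n (r ◅◅ lam-⇛* p [])) (reach* v 1 q′))

    app-dec : ∀ {L V T} → L ⊢[ A ] V → L ⊢[ A ] T → Dec (L ⊢[ A ] app V T)
    app-dec {L} {V} {T} v t with ⟦⟧-spine T (⟪⟫-spine L)
    ... | n , h with isLam-dec (⟦⟧₀-typed t n)
    -- If `T` became an abstraction at any level, its arity would be an arrow, and then level `n`,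
    -- whose spine ends in a sort, would be an abstraction too.
    ... | no ¬l = no λ { (v-app {n = m} _ _ _ r _) →
        ¬l (spine-isLam (typed-at-lam t r n) (h n ≤-refl)) }
    ... | yes l with least (λ m → isLam-dec (⟦⟧₀-typed t m)) n l
    -- The levels at which `T` is an abstraction are exactly those from `n₁` on, so `A` contains one
    -- of them if and only if it has an element not below `n₁`.
    ... | n₁ , l₁ , minimal with bounded? n₁
    ... | no ¬b = no λ { (v-app {n = m} _ _ a r _) →
        ¬b (m , a , minimal m (subst (IsLam ∘ ⟦ T ⟧₀ L) (+-identityʳ m)
          (isLam-≃ (proj₂ (⟶*-isLam t r 0)) (_ , _ , [])))) }
    ... | yes (n₂ , a , n₁≤n₂) with isLam-upward t n₁≤n₂ l₁
    ... | _ , _ , r = domain-dec v t a r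

    extend-dec : ∀ {L V} b → Dec (L ⊢[ A ] V) → (∀ i → Dec (L ⊢[ A ] var i)) →
                 ∀ i → Dec ((L , b ⟨ V ⟩) ⊢[ A ] var i)
    extend-dec b v? e? zero    = map′ v-var0 (λ { (v-var0 v) → v }) v?
    extend-dec b v? e? (suc i) = map′ v-varS (λ { (v-varS v) → v }) (e? i)

    term-dec : ∀ {L} → (∀ i → Dec (L ⊢[ A ] var i)) → ∀ T → Dec (L ⊢[ A ] T)
    term-dec e? (sort s) = yes v-sort
    term-dec e? (var i)  = e? i
    term-dec e? (app V T) with term-dec e? V | term-dec e? T
    ... | yes v | yes t = app-dec v t
    ... | no ¬v | _     = no λ { (v-app v _ _ _ _) → ¬v v }
    ... | _     | no ¬t = no λ { (v-app _ t _ _ _) → ¬t t }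
    term-dec e? (bind b V T) =
      map′ (λ (v , t) → v-bind v t) (λ { (v-bind v t) → v , t })
        (term-dec e? V ×-dec term-dec (extend-dec b (term-dec e? V) e?) T)
    term-dec e? (cast U T) with term-dec e? U | term-dec e? T
    ... | yes u | yes t = cast-dec u t
    ... | no ¬u | _     = no λ { (v-cast u _ _ _) → ¬u u }
    ... | _     | no ¬t = no λ { (v-cast _ t _ _) → ¬t t }

    var-dec : ∀ L i → Dec (L ⊢[ A ] var i)
    var-dec ∅             i = no λ ()
    var-dec (K , b ⟨ V ⟩)   = extend-dec b (term-dec (var-dec K) V) (var-dec K)

theorem5p4 : {S : Set} → S → DecidableEquality S → (next : S → S) →
    (A : ℕ → Set) → ((n₁ : ℕ) → Dec (∃[ n₂ ] (A n₂ × n₁ ≤ n₂))) →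
    (L : Env S) (T U : Term S) → Dec (Calculus._⊢[_]_∶_ next L A T U)
theorem5p4 s₀ _≟_ next A bounded? L T U =
  term-dec _≟_ A bounded? (var-dec _≟_ A bounded? L) (cast U T)
  where open Semantics next s₀
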